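{- The functions sending $(1^n\,0\,1^a\,0\,1^b)$, where $1\le a\le b\le n$, to the differences $$\binom{n}{a}\binom{n}{b}-\binom{n}{a-1}\binom{n}{b+1}\quad\text{and}\quad\binom{n+a}{n}\binom{n+b}{n}-\binom{n+a-1}{n}\binom{n+b+1}{n}$$ are both in $\#\mathsf{L}$.
   Context: The alphabet is $\Sigma=\{0,1\}$; $1^a$ is the string of $a$ ones and juxtaposition is concatenation. A function given only on strings of a specified form is extended by $0$ to all other strings. $\#\mathsf{L}$ is the class of functions $f:\Sigma^*\to\mathbb{N}_0$ such that $f(x)$ is the number of accepting computation paths on input $x$ of a fixed nondeterministic Turing machine with read-only input tape that uses $O(\log|x|)$ work space and halts on every computation path. Equivalently: there are a polynomial $q$ and a deterministic $O(\log|x|)$-space Turing machine $M$ with an additional read-once, left-to-right witness tape such that $f(x)=\#\{w\in\Sigma^{q(|x|)}\mid M(x,w)=\mathsf{yes}\}$. -}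

module Defs where

open import Data.Bool using (Bool; true; false; T)
open import Data.Empty using (⊥-elim)
open import Data.Fin using (Fin)
open import Data.Integer using (ℤ; 0ℤ)
open import Data.List using (List; []; _∷_; _++_; length; map; replicate)
open import Data.List.Membership.Propositional using (_∈_)
open import Data.List.Properties using (∷-injectiveʳ)
open import Data.List.Relation.Unary.Unique.Propositional using (Unique)
open import Data.Nat using (ℕ; zero; suc; _+_; _*_; _≤_; _≤?_)
open import Data.Nat.Logarithm using (⌊log₂_⌋)
open import Data.Product using (Σ; ∃; ∃₂; _×_; _,_; proj₂)
open import Data.Sum using (_⊎_; inj₁; inj₂)
open import Data.Vec as Vec using (Vec)
open import Function using (flip)
open import Function.Bundles using (_↔_)
open import Induction.WellFounded using (Acc)
open import Relation.Binary.Construct.Closure.ReflexiveTransitive using (Star)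
open import Relation.Binary.PropositionalEquality
  using (_≡_; _≢_; refl; sym; cong)
open import Relation.Nullary using (¬_; Dec; yes; no)

data Move : Set where
  left stay right : Move

-- `before` lists the cells to the left of the head, nearest cell first.
record Tape (A : Set) : Set where
  constructor tape
  field
    before  : List A
    scanned : A
    after   : List A

open Tape public

write : {A : Set} → A → Tape A → Tape A
write a (tape ls _ rs) = tape ls a rs

-- Work tapes are infinite in both directions; a blank cell is materialised
-- when it is first scanned, and cells are never discarded.  Hence `cells`
-- is the number of cells visited so far.
moveOn : {A : Set} → A → Move → Tape A → Tape A
moveOn blank left  (tape []       a rs)       = tape [] blank (a ∷ rs)
moveOn blank left  (tape (l ∷ ls) a rs)       = tape ls l (a ∷ rs)
moveOn blank stay  t                          = t
moveOn blank right (tape ls       a [])       = tape (a ∷ ls) blank []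
moveOn blank right (tape ls       a (r ∷ rs)) = tape (a ∷ ls) r rs

cells : {A : Set} → Tape A → ℕ
cells (tape ls _ rs) = length ls + suc (length rs)

-- The input tape is finite: the head cannot leave it.
moveWithin : {A : Set} → Move → Tape A → Tape A
moveWithin left  (tape []       a rs)       = tape [] a rs
moveWithin left  (tape (l ∷ ls) a rs)       = tape ls l (a ∷ rs)
moveWithin stay  t                          = t
moveWithin right (tape ls       a [])       = tape ls a []
moveWithin right (tape ls       a (r ∷ rs)) = tape (a ∷ ls) r rs

data InputSymbol : Set where
  ⊢ ⊣ : InputSymbol
  bit : Bool → InputSymbol

inputTape : List Bool → Tape InputSymbol
inputTape x = tape [] ⊢ (map bit x ++ ⊣ ∷ [])

record Config (State Symbol : Set) (k : ℕ) : Set where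
  constructor config
  field
    state : State
    input : Tape InputSymbol
    work  : Vec (Tape Symbol) k

open Config public

record NTM : Set₁ where
  field
    State   : Set
    Symbol  : Set
    #states #symbols : ℕ
    State-finite  : State ↔ Fin #states
    Symbol-finite : Symbol ↔ Fin #symbols
    #tapes : ℕ
    start  : State
    accept : State → Bool
    blank  : Symbol

  -- New state, move of the input head, and for each work tape the symbol
  -- written followed by the move of its head.
  Transition : Set
  Transition = State × Move × Vec (Symbol × Move) #tapes

  field
    δ : State → InputSymbol → Vec Symbol #tapes → List Transition
    -- The available transitions form a set, so a repeated entry cannot be
    -- used to count a path twice.
    δ-unique : ∀ q i ws → Unique (δ q i ws)

  Configuration : Set
  Configuration = Config State Symbol #tapes

  initial : List Bool → Configuration
  initial x = config start (inputTape x) (Vec.replicate #tapes (tape [] blank []))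

  enabled : Configuration → List Transition
  enabled (config q i ws) = δ q (scanned i) (Vec.map scanned ws)

  act : Symbol × Move → Tape Symbol → Tape Symbol
  act (s , m) t = moveOn blank m (write s t)

  apply : Transition → Configuration → Configuration
  apply (q , m , as) (config _ i ws) = config q (moveWithin m i) (Vec.zipWith act as ws)

  _⟶_ : Configuration → Configuration → Set
  c ⟶ d = ∃ λ t → t ∈ enabled c × d ≡ apply t c

  -- Every computation path from the initial configuration is finite, stated
  -- inductively.
  HaltsOn : List Bool → Set
  HaltsOn x = Acc (flip _⟶_) (initial x)

  workSpace : Configuration → ℕ
  workSpace c = Vec.sum (Vec.map cells (work c))

  LogSpace : Set
  LogSpace = ∃₂ λ k n₀ → ∀ x → n₀ ≤ length x →
    ∀ c → Star _⟶_ (initial x) c → workSpace c ≤ k * ⌊log₂ length x ⌋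

  -- A path is a maximal sequence of transitions; it accepts if the state in
  -- which it halts is accepting.
  data AcceptingPath (c : Configuration) : Set where
    halt : enabled c ≡ [] → T (accept (state c)) → AcceptingPath c
    step : ∀ t → t ∈ enabled c → AcceptingPath (apply t c) → AcceptingPath c

_∈#L : (List Bool → ℕ) → Set₁
f ∈#L = Σ NTM λ M → let open NTM M in
  (∀ x → HaltsOn x) × LogSpace × (∀ x → AcceptingPath (initial x) ↔ Fin (f x))

infix 4 _∈#L

ones : ℕ → List Bool
ones k = replicate k true

encode : ℕ → ℕ → ℕ → List Bool
encode n a b = ones n ++ false ∷ ones a ++ false ∷ ones b

Encodes : List Bool → ℕ → ℕ → ℕ → Set
Encodes x n a b = 1 ≤ a × a ≤ b × b ≤ n × x ≡ encode n a b

WellFormed : List Bool → Set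
WellFormed x = ∃ λ n → ∃₂ λ a b → Encodes x n a b

split : ∀ x → (∃ λ k → x ≡ ones k) ⊎ (∃₂ λ k y → x ≡ ones k ++ false ∷ y)
split []          = inj₁ (0 , refl)
split (false ∷ y) = inj₂ (0 , y , refl)
split (true ∷ x) with split x
... | inj₁ (k , e)     = inj₁ (suc k , cong (true ∷_) e)
... | inj₂ (k , y , e) = inj₂ (suc k , y , cong (true ∷_) e)

ones-no-zero : ∀ k l {y} → ones k ≢ ones l ++ false ∷ y
ones-no-zero zero    zero    ()
ones-no-zero zero    (suc l) ()
ones-no-zero (suc k) zero    ()
ones-no-zero (suc k) (suc l) e = ones-no-zero k l (∷-injectiveʳ e)

ones-injective : ∀ k l → ones k ≡ ones l → k ≡ l
ones-injective zero    zero    _ = refl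
ones-injective (suc k) (suc l) e = cong suc (ones-injective k l (∷-injectiveʳ e))

block-injective : ∀ k l {y z} → ones k ++ false ∷ y ≡ ones l ++ false ∷ z → k ≡ l × y ≡ z
block-injective zero    zero    refl = refl , refl
block-injective (suc k) (suc l) e with block-injective k l (∷-injectiveʳ e)
... | k≡l , y≡z = cong suc k≡l , y≡z

encode-injective : ∀ {n a b n′ a′ b′} → encode n a b ≡ encode n′ a′ b′ →
                   n ≡ n′ × a ≡ a′ × b ≡ b′
encode-injective {n} {a} {b} {n′} {a′} {b′} e with block-injective n n′ e
... | n≡ , e₁ with block-injective a a′ e₁
...   | a≡ , e₂ = n≡ , a≡ , ones-injective b b′ e₂

wellFormed? : ∀ x → Dec (WellFormed x)
wellFormed? x with split x
... | inj₁ (k , refl) = no λ (n , a , b , _ , _ , _ , e) → ones-no-zero k n e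
... | inj₂ (n , y , refl) with split y
...   | inj₁ (k , refl) = no λ (n′ , a , b , _ , _ , _ , e) →
          ones-no-zero k a (proj₂ (block-injective n n′ e))
...   | inj₂ (a , z , refl) with split z
...     | inj₂ (k , w , refl) = no λ (n′ , a′ , b , _ , _ , _ , e) →
            ones-no-zero b k
              (sym (proj₂ (block-injective a a′ (proj₂ (block-injective n n′ e)))))
...     | inj₁ (b , refl) with 1 ≤? a | a ≤? b | b ≤? n
...       | yes p | yes q | yes r = yes (n , a , b , p , q , r , refl)
...       | no ¬p | _     | _     = no λ where
              (_ , _ , _ , p , _ , _ , e) → case-a (encode-injective {n} {a} {b} e) p
  where
  case-a : ∀ {n′ a′ b′} → n ≡ n′ × a ≡ a′ × b ≡ b′ → ¬ (1 ≤ a′)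
  case-a (refl , refl , refl) = ¬p
...       | yes _ | no ¬q | _     = no λ where
              (_ , _ , _ , _ , q , _ , e) → case-b (encode-injective {n} {a} {b} e) q
  where
  case-b : ∀ {n′ a′ b′} → n ≡ n′ × a ≡ a′ × b ≡ b′ → ¬ (a′ ≤ b′)
  case-b (refl , refl , refl) = ¬q
...       | yes _ | yes _ | no ¬r = no λ where
              (_ , _ , _ , _ , _ , r , e) → case-n (encode-injective {n} {a} {b} e) r
  where
  case-n : ∀ {n′ a′ b′} → n ≡ n′ × a ≡ a′ × b ≡ b′ → ¬ (b′ ≤ n′)
  case-n (refl , refl , refl) = ¬r

-- The parameters returned by wellFormed? are the only ones, by encode-injective.
extendByZero : (ℕ → ℕ → ℕ → ℤ) → List Bool → ℤ
extendByZero g x with wellFormed? x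
... | yes (n , a , b , _) = g n a b
... | no _                = 0ℤ

extendByZero-on : ∀ g {n a b} → 1 ≤ a → a ≤ b → b ≤ n →
                  extendByZero g (encode n a b) ≡ g n a b
extendByZero-on g {n} {a} {b} p q r with wellFormed? (encode n a b)
... | no ¬w = ⊥-elim (¬w (n , a , b , p , q , r , refl))
... | yes (_ , _ , _ , _ , _ , _ , e) with encode-injective {n} {a} {b} e
...   | refl , refl , refl = refl

extendByZero-off : ∀ g {x} → ¬ WellFormed x → extendByZero g x ≡ 0ℤ
extendByZero-off g {x} ¬w with wellFormed? x
... | yes w = ⊥-elim (¬w w)
... | no _  = refl

{-# OPTIONS --safe #-}
module Submission where

-- Combinatorial idea.  Write d = b - a.  The first difference counts the pairs
-- (S , U) of subsets of [n] with |S| = a and |U| = b such that every initial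
-- segment of [n] contains at least as many elements of U as of S: reflecting
-- the walk that records the excess of U over S at its first visit to -1 turns
-- the bad pairs into all pairs of subsets with a - 1 and b + 1 elements.  The
-- second difference counts, in the same way, pairs of multisets over n + 1
-- values, that is, two-rowed semistandard tableaux.  Scanning the ground set
-- from its last element down, such a pair is produced by local choices that
-- need only two numbers: a, the elements of S still to be placed, and d, the
-- excess of U over S among those still to be placed; a pair is complete when both
-- are zero at the end.  The numbers of completions satisfy the recurrences that
-- define subsetPairs and multisetPairs, and Pascal's rule shows that the two
-- differences of products of binomial coefficients satisfy them as well
-- (subsetPairs-formula, multisetPairs-formula).
--
-- Machine.  The choices are made by a nondeterministic program with three
-- counters.  A pass to the right checks the format of the input and b ≤ n; a
-- pass back to the left loads a and b - a, rejecting if a > b; continuing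
-- through the block of n ones, each symbol stands for one element of the
-- ground set (for multisets, the end marker stands for one more), and the program
-- guesses and updates the two counters.  So its accepting paths correspond to the
-- pairs that are counted, and malformed inputs have none.
--
-- Compilation.  All counters stay at most |x| + 1, so each is kept in binary on
-- its own work tape, in logarithmic space; increments and decrements are
-- deterministic sweeps over the digits, which neither create nor merge paths
-- (program-∈#L).  Halting, the space bound and the number of accepting paths are
-- all read off one inductive certificate, a finite computation tree.

open import Defs
open import Axiom.UniquenessOfIdentityProofs.WithK using (uip)
open import Data.Bool using (Bool; true; false; T; if_then_else_)
open import Data.Empty using (⊥-elim)
open import Data.Fin using (Fin; zero; suc)
open import Data.Fin.Patterns
open import Data.Fin.Properties using (+↔⊎; *↔×; 0↔⊥; 1↔⊤)
open import Data.Integer using (+_; _⊖_)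
open import Data.Integer.Properties using (⊖-≥)
open import Data.List using (List; []; _∷_; _++_; length; map; replicate; _ʳ++_)
open import Data.List.Membership.Propositional using (_∈_)
open import Data.List.Properties using (length-++; length-map; length-replicate; map-id)
open import Data.List.Relation.Unary.All using ([]; _∷_)
open import Data.List.Relation.Unary.Any using (here; there)
open import Data.List.Relation.Unary.Unique.Propositional using (Unique; []; _∷_)
open import Data.Maybe using (Maybe; just; nothing)
open import Data.Nat using (ℕ; zero; suc; _+_; _∸_; _*_; _^_; _≤_; _<_; _≤?_; z≤n; s≤s; s≤s⁻¹)
open import Data.Nat.Combinatorics
  using (_C_; nCn≡1; nCk≡nC[n∸k]; k>n⇒nCk≡0; nCk+nC[k+1]≡[n+1]C[k+1])
open import Data.Nat.Logarithm
  using (⌊log₂_⌋; ⌊log₂⌋-mono-≤; ⌊log₂[2*b]⌋≡1+⌊log₂b⌋; ⌊log₂[2^n]⌋≡n)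
open import Data.Nat.Properties
open import Data.Nat.Tactic.RingSolver using (solve-∀)
open import Data.Product using (∃; ∃-syntax; _×_; _,_; proj₁; proj₂)
open import Data.Product.Function.NonDependent.Propositional using (_×-↔_)
open import Data.Sum using (_⊎_; inj₁; inj₂)
open import Data.Sum.Function.Propositional using (_⊎-↔_)
open import Data.Vec as Vec using (Vec; []; _∷_; lookup; updateAt; _[_]≔_)
open import Data.Vec.Properties
  using (updateAt-updateAt; updateAt-id; lookup∘update; lookup-map; []≔-lookup)
open import Data.Vec.Relation.Binary.Pointwise.Inductive as Pointwise using (Pointwise; []; _∷_)
open import Data.Vec.Relation.Unary.All using (All; []; _∷_)
open import Function using (flip; const; id; _∘_)
open import Function.Bundles using (_↔_; mk↔ₛ′)
open import Function.Construct.Composition using (_↔-∘_)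
open import Function.Construct.Identity using (↔-id)
open import Function.Construct.Symmetry using (↔-sym)
open import Induction.WellFounded using (Acc; acc)
open import Relation.Binary.Construct.Closure.ReflexiveTransitive using (Star; ε; _◅_)
open import Relation.Binary.PropositionalEquality
open import Relation.Nullary using (¬_; Dec; yes; no)

-- Computation trees

module ComputationTree (M : NTM) where
  open NTM M

  -- `Tree S c n`: all paths from c are finite, stay within S work cells, and
  -- exactly n of them accept.  At most two transitions are enabled at a time,
  -- which is all that the machines below need.
  data Tree (S : ℕ) (c : Configuration) : ℕ → Set where
    leaf   : workSpace c ≤ S → enabled c ≡ [] →
             Tree S c (if accept (state c) then 1 else 0)
    single : ∀ {t n} → workSpace c ≤ S → enabled c ≡ t ∷ [] →
             Tree S (apply t c) n → Tree S c n
    fork   : ∀ {t u m n} → workSpace c ≤ S → enabled c ≡ t ∷ u ∷ [] →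
             Tree S (apply t c) m → Tree S (apply u c) n → Tree S c (m + n)

  ∈-transport : ∀ {t : Transition} {ts us} → ts ≡ us → t ∈ ts → t ∈ us
  ∈-transport refl m = m

  tree⇒halts : ∀ {S c n} → Tree S c n → Acc (flip _⟶_) c
  tree⇒halts {c = c} (leaf _ e) = acc λ where
      (u , m , refl) → next (∈-transport e m)
    where
    next : ∀ {u} → u ∈ [] → Acc (flip _⟶_) (apply u c)
    next ()
  tree⇒halts {S} {c} (single {t} {n} _ e T₁) = acc λ where
      (u , m , refl) → next (∈-transport e m)
    where
    next : ∀ {u} → u ∈ t ∷ [] → Acc (flip _⟶_) (apply u c)
    next (here refl) = tree⇒halts T₁
  tree⇒halts {S} {c} (fork {t} {t′} _ e T₁ T₂) = acc λ where
      (u , m , refl) → next (∈-transport e m)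
    where
    next : ∀ {u} → u ∈ t ∷ t′ ∷ [] → Acc (flip _⟶_) (apply u c)
    next (here refl)         = tree⇒halts T₁
    next (there (here refl)) = tree⇒halts T₂

  tree⇒space : ∀ {S c n} → Tree S c n → ∀ {d} → Star _⟶_ c d → workSpace d ≤ S
  tree⇒space (leaf s _)     ε = s
  tree⇒space (single s _ _) ε = s
  tree⇒space (fork s _ _ _) ε = s
  tree⇒space (leaf _ e) ((t , m , refl) ◅ p) with ∈-transport e m
  ... | ()
  tree⇒space (single _ e T₁) ((t , m , refl) ◅ p) with ∈-transport e m
  ... | here refl = tree⇒space T₁ p
  tree⇒space (fork _ e T₁ T₂) ((t , m , refl) ◅ p) with ∈-transport e m
  ... | here refl         = tree⇒space T₁ p
  ... | there (here refl) = tree⇒space T₂ p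

  private
    T↔Fin : ∀ b → T b ↔ Fin (if b then 1 else 0)
    T↔Fin true  = ↔-sym 1↔⊤
    T↔Fin false = ↔-sym 0↔⊥

    -- A halted configuration has no other path than `halt`, whose first argument is
    -- a proof of an equation and hence unique.
    leaf-paths : ∀ {c} → enabled c ≡ [] → T (accept (state c)) ↔ AcceptingPath c
    leaf-paths {c} e = mk↔ₛ′ (halt e) back there∘back (λ _ → refl)
      where
      back : AcceptingPath c → T (accept (state c))
      back (halt _ a) = a
      back (step t m _) with ∈-transport e m
      ... | ()
      there∘back : ∀ p → halt e (back p) ≡ p
      there∘back (halt e′ a) = cong (λ e → halt e a) (uip e e′)
      there∘back (step t m _) with ∈-transport e m
      ... | ()

    -- The paths from a configuration with enabled transitions, classified by
    -- the position of their first transition.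
    Branches : Configuration → List Transition → Set
    Branches c ts = ∃ λ t → t ∈ ts × AcceptingPath (apply t c)

    branches : ∀ {c t ts} → enabled c ≡ t ∷ ts → Branches c (t ∷ ts) ↔ AcceptingPath c
    branches {c} {t₀} {ts} e = mk↔ₛ′ forth back forth∘back back∘forth
      where
      forth : Branches c (t₀ ∷ ts) → AcceptingPath c
      forth (t , m , p) = step t (∈-transport (sym e) m) p
      back : AcceptingPath c → Branches c (t₀ ∷ ts)
      back (halt e′ _) with trans (sym e) e′
      ... | ()
      back (step t m p) = t , ∈-transport e m , p
      transport-inverse : ∀ {t : Transition} {us vs} (q : us ≡ vs) (m : t ∈ us) →
                          ∈-transport (sym q) (∈-transport q m) ≡ m
      transport-inverse refl m = refl
      transport-inverse′ : ∀ {t : Transition} {us vs} (q : us ≡ vs) (m : t ∈ vs) →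
                           ∈-transport q (∈-transport (sym q) m) ≡ m
      transport-inverse′ refl m = refl
      forth∘back : ∀ p → forth (back p) ≡ p
      forth∘back (halt e′ _) with trans (sym e) e′
      ... | ()
      forth∘back (step t m p) = cong (λ m → step t m p) (transport-inverse e m)
      back∘forth : ∀ b → back (forth b) ≡ b
      back∘forth (t , m , p) = cong (λ m → t , m , p) (transport-inverse′ e m)

    one-branch : ∀ {c t} → AcceptingPath (apply t c) ↔ Branches c (t ∷ [])
    one-branch {c} {t} = mk↔ₛ′ (λ p → t , here refl , p) (λ { (_ , here refl , p) → p })
      (λ { (_ , here refl , p) → refl }) (λ _ → refl)

    two-branches : ∀ {c t u} → (AcceptingPath (apply t c) ⊎ AcceptingPath (apply u c)) ↔
                               Branches c (t ∷ u ∷ [])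
    two-branches {c} {t} {u} = mk↔ₛ′
      (λ { (inj₁ p) → t , here refl , p ; (inj₂ p) → u , there (here refl) , p })
      (λ { (_ , here refl , p) → inj₁ p ; (_ , there (here refl) , p) → inj₂ p })
      (λ { (_ , here refl , p) → refl ; (_ , there (here refl) , p) → refl })
      (λ { (inj₁ p) → refl ; (inj₂ p) → refl })

  tree⇒paths : ∀ {S c n} → Tree S c n → AcceptingPath c ↔ Fin n
  tree⇒paths {c = c} (leaf _ e) = T↔Fin (accept (state c)) ↔-∘ ↔-sym (leaf-paths e)
  tree⇒paths {c = c} (single _ e T₁) =
    tree⇒paths T₁ ↔-∘ ↔-sym (branches e ↔-∘ one-branch {c})
  tree⇒paths {c = c} (fork _ e T₁ T₂) =
    (↔-sym +↔⊎ ↔-∘ (tree⇒paths T₁ ⊎-↔ tree⇒paths T₂)) ↔-∘ ↔-sym (branches e ↔-∘ two-branches {c})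

-- Binary numerals

-- Digits are listed least significant first; leading zeros are allowed.
value : List Bool → ℕ
value []           = 0
value (false ∷ bs) = 2 * value bs
value (true ∷ bs)  = suc (2 * value bs)

increment : List Bool → List Bool
increment []           = true ∷ []
increment (false ∷ bs) = true ∷ bs
increment (true ∷ bs)  = false ∷ increment bs

-- Meaningful on positive values only.
decrement : List Bool → List Bool
decrement []           = []
decrement (false ∷ bs) = true ∷ decrement bs
decrement (true ∷ bs)  = false ∷ bs

value-increment : ∀ bs → value (increment bs) ≡ suc (value bs)
value-increment []           = refl
value-increment (false ∷ bs) = refl
value-increment (true ∷ bs)  = trans (cong (2 *_) (value-increment bs)) (*-suc 2 (value bs))

value-decrement : ∀ bs {m} → value bs ≡ suc m → value (decrement bs) ≡ m
value-decrement (true ∷ bs) refl = refl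
value-decrement (false ∷ bs) {m} e with value bs in eq
... | suc k = suc-injective
  (trans (cong (λ v → 2 + 2 * v) (value-decrement bs eq)) (trans (sym (*-suc 2 k)) e))

length-decrement : ∀ bs → length (decrement bs) ≡ length bs
length-decrement []           = refl
length-decrement (false ∷ bs) = cong suc (length-decrement bs)
length-decrement (true ∷ bs)  = refl

-- A new digit is created only when the value reaches a power of two.  Hence the
-- number of digits is governed by the largest value reached, despite leading
-- zeros left by decrements.
length-increment : ∀ bs → length (increment bs) ≡ length bs ⊎
                          2 ^ length (increment bs) ≡ 2 * value (increment bs)
length-increment []           = inj₂ refl
length-increment (false ∷ bs) = inj₁ refl
length-increment (true ∷ bs) with length-increment bs
... | inj₁ e = inj₁ (cong suc e)
... | inj₂ e = inj₂ (cong (2 *_) e)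

-- Counter programs and their compilation to Turing machines

-- Instructions of a program with k counters: `inc` and `dec` change one counter,
-- `dec` branching without change if it is zero; `read` moves the input head and
-- jumps depending on the scanned input symbol; `choose` is a nondeterministic
-- jump; `stop` halts with the given verdict.
data Instruction (Label : Set) (k : ℕ) : Set where
  inc    : Fin k → Label → Instruction Label k
  dec    : Fin k → (positive zero : Label) → Instruction Label k
  read   : (InputSymbol → Move × Label) → Instruction Label k
  choose : ∀ (l l′ : Label) → l ≢ l′ → Instruction Label k
  stop   : Bool → Instruction Label k

-- A program over a finite set of labels, started at `entry` with all counters zero.
record Program : Set₁ where
  field
    Label        : Set
    #labels      : ℕ
    Label-finite : Label ↔ Fin #labels
    #counters    : ℕ
    entry        : Label
    code         : Label → Instruction Label #counters

-- A cell of a work tape: blank or a binary digit.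
Cell : Set
Cell = Maybe Bool

Cell-finite : Cell ↔ Fin 3
Cell-finite = mk↔ₛ′
  (λ { nothing → 0F ; (just false) → 1F ; (just true) → 2F })
  (λ { 0F → nothing ; 1F → just false ; 2F → just true })
  (λ { 0F → refl ; 1F → refl ; 2F → refl })
  (λ { nothing → refl ; (just false) → refl ; (just true) → refl })

-- An `inc` or `dec` takes several steps of the machine.  From the home cell, left
-- of the digits, the head leaves (ready) and moves right propagating a carry or
-- borrow (scan), then comes back over unchanged digits (return).  A borrow that
-- reaches the end has met the value zero and turned all its digits into ones;
-- they are reset to zeros on the way back (restore).
Phase : Set
Phase = Fin 4

pattern ready   = 0F
pattern scan    = 1F
pattern return  = 2F
pattern restore = 3F

module Compile (P : Program) where
  open Program P

  Control : Set
  Control = Label × Phase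

  -- The next control, the symbol written and the move, on the tape of the counter.
  incStep : Label → Label → Phase → Cell → Control × Cell × Move
  incStep l l′ ready   c            = (l , scan) , c , right
  incStep l l′ scan    (just true)  = (l , scan) , just false , right
  incStep l l′ scan    (just false) = (l , return) , just true , stay
  incStep l l′ scan    nothing      = (l , return) , just true , stay
  incStep l l′ return  (just b)     = (l , return) , just b , left
  incStep l l′ return  nothing      = (l′ , ready) , nothing , stay
  -- never entered: an increment has no phase `restore`
  incStep l l′ restore c            = (l′ , ready) , c , stay

  decStep : Label → Label → Label → Phase → Cell → Control × Cell × Move
  decStep l p z ready   c            = (l , scan) , c , right
  decStep l p z scan    (just true)  = (l , return) , just false , stay
  decStep l p z scan    (just false) = (l , scan) , just true , right
  decStep l p z scan    nothing      = (l , restore) , nothing , left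
  decStep l p z return  (just b)     = (l , return) , just b , left
  decStep l p z return  nothing      = (p , ready) , nothing , stay
  decStep l p z restore (just _)     = (l , restore) , just false , left
  decStep l p z restore nothing      = (z , ready) , nothing , stay

  Action : Set
  Action = Control × Move × Vec (Cell × Move) #counters

  idle : ∀ {k} → Vec Cell k → Vec (Cell × Move) k
  idle = Vec.map (_, stay)

  -- The action performing a step on tape j only.
  onTape : Fin #counters → Control × Cell × Move → Vec Cell #counters → Action
  onTape j (q , a) ss = q , stay , idle ss [ j ]≔ a

  -- The transitions available to the instruction at label l; `read`, `choose` and
  -- `stop` leave the work tapes alone.
  exec : Label → Instruction Label #counters → Phase → InputSymbol → Vec Cell #counters → List Action
  exec l (inc j l′)       ph σ ss = onTape j (incStep l l′ ph (lookup ss j)) ss ∷ []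
  exec l (dec j p z)      ph σ ss = onTape j (decStep l p z ph (lookup ss j)) ss ∷ []
  exec l (read f)         ph σ ss = ((proj₂ (f σ) , ready) , proj₁ (f σ) , idle ss) ∷ []
  exec l (choose l₁ l₂ _) ph σ ss = ((l₁ , ready) , stay , idle ss) ∷
                                    ((l₂ , ready) , stay , idle ss) ∷ []
  exec l (stop _)         ph σ ss = []

  exec-unique : ∀ l i ph σ ss → Unique (exec l i ph σ ss)
  exec-unique l (inc _ _)        ph σ ss = [] ∷ []
  exec-unique l (dec _ _ _)      ph σ ss = [] ∷ []
  exec-unique l (read _)         ph σ ss = [] ∷ []
  exec-unique l (choose _ _ l≢l′) ph σ ss = ((λ e → l≢l′ (cong (proj₁ ∘ proj₁) e)) ∷ []) ∷ [] ∷ []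
  exec-unique l (stop _)         ph σ ss = []

  verdict : Instruction Label #counters → Bool
  verdict (stop b) = b
  verdict _        = false

  machine : NTM
  machine = record
    { State = Control ; Symbol = Cell ; #states = #labels * 4 ; #symbols = 3
    ; State-finite = ↔-sym (*↔× {#labels} {4}) ↔-∘ (Label-finite ×-↔ ↔-id Phase)
    ; Symbol-finite = Cell-finite
    ; #tapes = #counters
    ; start = entry , ready
    ; accept = λ (l , _) → verdict (code l)
    ; blank = nothing
    ; δ = λ (l , ph) → exec l (code l) ph
    ; δ-unique = λ (l , ph) → exec-unique l (code l) ph
    }

  open NTM machine using (Configuration; initial; enabled; act; apply; workSpace)
  open ComputationTree machine public

  act-idle : ∀ {k} (ws : Vec (Tape Cell) k) → Vec.zipWith act (idle (Vec.map scanned ws)) ws ≡ ws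
  act-idle []       = refl
  act-idle (w ∷ ws) = cong (w ∷_) (act-idle ws)

  act-onTape : ∀ {k} j a (ws : Vec (Tape Cell) k) →
               Vec.zipWith act (idle (Vec.map scanned ws) [ j ]≔ a) ws ≡ updateAt ws j (act a)
  act-onTape zero    a (w ∷ ws) = cong (act a w ∷_) (act-idle ws)
  act-onTape (suc j) a (w ∷ ws) = cong (w ∷_) (act-onTape j a ws)

  -- The work tape of a counter at rest: the head is on the blank home cell, to
  -- the right of which are the digits, possibly followed by a blank cell that
  -- an earlier step has materialised.
  counter : List Bool → List Cell → Tape Cell
  counter bs pad = tape [] nothing (map just bs ++ pad)

  Padding : List Cell → Set
  Padding pad = pad ≡ [] ⊎ pad ≡ nothing ∷ []

  -- The tape t represents the value v, with no more digits than values up to V need.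
  data Holds (V : ℕ) (t : Tape Cell) (v : ℕ) : Set where
    holds : ∀ bs pad → Padding pad → t ≡ counter bs pad → value bs ≡ v →
            2 ^ length bs ≤ 2 * V → Holds V t v

  -- A bound on the cells of a tape holding values up to V: the digits, the home
  -- cell and a blank cell after the digits.
  width : ℕ → ℕ
  width V = 2 + ⌊log₂ (2 * V) ⌋

  fits : ∀ V (bs : List Bool) → 2 ^ length bs ≤ 2 * V → 2 + length bs ≤ width V
  fits V bs h = s≤s (s≤s (subst (_≤ _) (⌊log₂[2^n]⌋≡n (length bs)) (⌊log₂⌋-mono-≤ h)))

  cells-counter : ∀ bs {pad} → Padding pad → cells (counter bs pad) ≤ 2 + length bs
  cells-counter bs (inj₁ refl) = s≤s (≤-trans (≤-reflexive eq) (n≤1+n _))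
    where
    eq : length (map just bs ++ []) ≡ length bs
    eq = trans (length-++ (map just bs)) (trans (+-identityʳ _) (length-map just bs))
  cells-counter bs (inj₂ refl) = s≤s (≤-reflexive eq)
    where
    eq : length (map just bs ++ nothing ∷ []) ≡ suc (length bs)
    eq = trans (length-++ (map just bs)) (trans (+-comm _ 1) (cong suc (length-map just bs)))

  -- Every tape has at most W cells.
  Fits : ∀ {k} → ℕ → Vec (Tape Cell) k → Set
  Fits W = All (λ t → cells t ≤ W)

  sum-cells : ∀ {k W} {ws : Vec (Tape Cell) k} → Fits W ws → Vec.sum (Vec.map cells ws) ≤ k * W
  sum-cells []       = z≤n
  sum-cells (h ∷ hs) = +-mono-≤ h (sum-cells hs)

  fits-update : ∀ {k W t} {ws : Vec (Tape Cell) k} j → cells t ≤ W → Fits W ws → Fits W (ws [ j ]≔ t)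
  fits-update zero    h (_ ∷ hs)  = h ∷ hs
  fits-update (suc j) h (h′ ∷ hs) = h′ ∷ fits-update j h hs

  -- An instruction at label l that works on tape j only, following the local rule
  -- ctl; the input tape i and the other work tapes ws stay as they are.
  module OnTape
    (l : Label) (j : Fin #counters) (ctl : Phase → Cell → Control × Cell × Move)
    (code-l : ∀ ph σ ss → exec l (code l) ph σ ss ≡ onTape j (ctl ph (lookup ss j)) ss ∷ [])
    (W : ℕ) (i : Tape InputSymbol) (ws : Vec (Tape Cell) #counters) (ws-fit : Fits W ws) where

    -- `At q t n`: with control q and tape j equal to t, there are n accepting paths,
    -- all within the space bound.
    At : Control → Tape Cell → ℕ → Set
    At q t n = Tree (#counters * W) (config q i (ws [ j ]≔ t)) n

    move-head : ∀ ph t {n} → cells t ≤ W →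
                At (proj₁ (ctl ph (scanned t))) (act (proj₂ (ctl ph (scanned t))) t) n → At (l , ph) t n
    move-head ph t h T₁ = single (sum-cells (fits-update j h ws-fit)) enabled-one
      (subst (λ c → Tree _ c _) (sym applied) T₁)
      where
      ss : Vec Cell #counters
      ss = Vec.map scanned (ws [ j ]≔ t)
      scanned-j : lookup ss j ≡ scanned t
      scanned-j = trans (lookup-map j scanned (ws [ j ]≔ t)) (cong scanned (lookup∘update j ws t))
      enabled-one : enabled (config (l , ph) i (ws [ j ]≔ t)) ≡ onTape j (ctl ph (scanned t)) ss ∷ []
      enabled-one = trans (code-l ph (scanned i) ss) (cong (λ s → onTape j (ctl ph s) ss ∷ []) scanned-j)
      applied : apply (onTape j (ctl ph (scanned t)) ss) (config (l , ph) i (ws [ j ]≔ t)) ≡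
                config (proj₁ (ctl ph (scanned t))) i (ws [ j ]≔ act (proj₂ (ctl ph (scanned t))) t)
      applied = cong (config _ i) (trans (act-onTape j _ (ws [ j ]≔ t)) (updateAt-updateAt j ws))

    -- The tape with the digits ls (nearest first) between home and the head,
    -- and the cells rs from the head on; past the last cell the head is on a
    -- fresh blank.
    facing : List Bool → List Cell → Tape Cell
    facing ls []       = tape (map just ls ++ nothing ∷ []) nothing []
    facing ls (r ∷ rs) = tape (map just ls ++ nothing ∷ []) r rs

    -- The same tape with the head one cell further left.
    behind : List Bool → List Cell → Tape Cell
    behind []       rs = tape [] nothing rs
    behind (d ∷ ls) rs = tape (map just ls ++ nothing ∷ []) (just d) rs

    go-right : ∀ b ls s rs →
               act (just b , right) (tape (map just ls ++ nothing ∷ []) s rs) ≡ facing (b ∷ ls) rs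
    go-right b ls s []       = refl
    go-right b ls s (r ∷ rs) = refl

    leave-home : ∀ rs → act (nothing , right) (tape [] nothing rs) ≡ facing [] rs
    leave-home []       = refl
    leave-home (r ∷ rs) = refl

    go-left : ∀ c ls s rs → act (c , left) (tape (map just ls ++ nothing ∷ []) s rs) ≡ behind ls (c ∷ rs)
    go-left c []       s rs = refl
    go-left c (d ∷ ls) s rs = refl

    cells-tape : ∀ (ls : List Bool) s rs →
                 cells (tape (map just ls ++ nothing ∷ []) s rs) ≡ 2 + (length ls + length rs)
    cells-tape ls s rs = begin
      length (map just ls ++ nothing ∷ []) + suc (length rs)
        ≡⟨ cong (_+ suc (length rs)) (length-++ (map just ls)) ⟩
      length (map just ls) + 1 + suc (length rs)
        ≡⟨ cong (λ k → k + 1 + suc (length rs)) (length-map just ls) ⟩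
      length ls + 1 + suc (length rs)                        ≡⟨ +-assoc (length ls) 1 _ ⟩
      length ls + suc (suc (length rs))                      ≡⟨ +-suc _ _ ⟩
      suc (length ls + suc (length rs))                      ≡⟨ cong suc (+-suc _ _) ⟩
      2 + (length ls + length rs)                            ∎
      where open ≡-Reasoning

    -- A move of the head, with the local control and the resulting tape given up to equality.
    move : ∀ ph {q a} t t′ {n} → cells t ≤ W → ctl ph (scanned t) ≡ (q , a) → act a t ≡ t′ →
           At q t′ n → At (l , ph) t n
    move ph t t′ h e refl T₁ = move-head ph t h (subst (λ (q , a) → At q (act a t) _) (sym e) T₁)

    -- Back to the home cell, rewriting each digit by w, then on to the label exit.
    sweep-back : ∀ ph exit w →
                 (∀ b → ctl ph (just b) ≡ ((l , ph) , just (w b) , left)) →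
                 ctl ph nothing ≡ ((exit , ready) , nothing , stay) →
                 ∀ ls bs pad {n} → suc (length ls + length (map just bs ++ pad)) ≤ W →
                 At (exit , ready) (counter (map w ls ʳ++ bs) pad) n →
                 At (l , ph) (behind ls (map just bs ++ pad)) n
    sweep-back ph exit w back done [] bs pad h = move ph _ _ h done refl
    sweep-back ph exit w back done (d ∷ ls) bs pad h T₁ =
      move ph _ _ (≤-trans (≤-reflexive (cells-tape ls (just d) (map just bs ++ pad))) h) (back d)
        (go-left (just (w d)) ls (just d) (map just bs ++ pad))
        (sweep-back ph exit w back done ls (w d ∷ bs) pad
          (subst (λ k → suc k ≤ W) (sym (+-suc (length ls) _)) h) T₁)

    length-pad : ∀ (bs : List Bool) {pad} → Padding pad → length (map just bs ++ pad) ≤ suc (length bs)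
    length-pad bs p = s≤s⁻¹ (cells-counter bs p)

    cells-facing : ∀ (ls bs : List Bool) {pad} → Padding pad → 2 + (length ls + length bs) ≤ W →
                   cells (facing ls (map just bs ++ pad)) ≤ W
    cells-facing ls []       (inj₁ refl) h = ≤-trans (≤-reflexive (cells-tape ls nothing [])) h
    cells-facing ls []       (inj₂ refl) h = ≤-trans (≤-reflexive (cells-tape ls nothing [])) h
    cells-facing ls (b ∷ bs) {pad} p     h =
      ≤-trans (≤-reflexive (cells-tape ls (just b) (map just bs ++ pad)))
      (≤-trans (s≤s (s≤s (+-monoʳ-≤ (length ls) (length-pad bs p)))) h)

    cells-rest : ∀ (ls bs : List Bool) {pad} → Padding pad → 2 + (length ls + suc (length bs)) ≤ W →
                 2 + (length ls + length (map just bs ++ pad)) ≤ W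
    cells-rest ls bs p h = ≤-trans (s≤s (s≤s (+-monoʳ-≤ (length ls) (length-pad bs p)))) h

    shift : ∀ (ls : List Bool) k → 2 + (length ls + suc k) ≤ W → 2 + (suc (length ls) + k) ≤ W
    shift ls k = subst (λ m → 2 + m ≤ W) (+-suc (length ls) k)

  module _ {l : Label} {j : Fin #counters} {l′ : Label} (code-l : code l ≡ inc j l′)
    {W : ℕ} (i : Tape InputSymbol) {ws : Vec (Tape Cell) #counters} (ws-fit : Fits W ws) where
    open OnTape l j (incStep l l′) (λ ph σ ss → cong (λ c → exec l c ph σ ss) code-l) W i ws ws-fit

    private
      rewind : ∀ ls bs pad {n} → suc (length ls + length (map just bs ++ pad)) ≤ W →
               At (l′ , ready) (counter (ls ʳ++ bs) pad) n →
               At (l , return) (behind ls (map just bs ++ pad)) n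
      rewind ls bs pad h T₁ = sweep-back return l′ (λ b → b) (λ _ → refl) refl ls bs pad h
        (subst (λ ds → At _ (counter (ds ʳ++ bs) pad) _) (sym (map-id ls)) T₁)

      -- A new leading digit replaces the blank cell after the digits, so the padding
      -- may change.
      carry : ∀ ls bs {pad n} → Padding pad → 2 + (length ls + length bs) ≤ W →
              (∀ pad′ → Padding pad′ → At (l′ , ready) (counter (ls ʳ++ increment bs) pad′) n) →
              At (l , scan) (facing ls (map just bs ++ pad)) n
      carry ls [] p@(inj₁ refl) h k =
        move scan _ _ (cells-facing ls [] p h) refl refl (rewind (true ∷ ls) [] [] h (k [] (inj₁ refl)))
      carry ls [] p@(inj₂ refl) h k =
        move scan _ _ (cells-facing ls [] p h) refl refl (rewind (true ∷ ls) [] [] h (k [] (inj₁ refl)))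
      carry ls (false ∷ bs) {pad} p h k =
        move scan _ _ (cells-facing ls (false ∷ bs) p h) refl refl
          (rewind (true ∷ ls) bs pad (cells-rest ls bs p h) (k pad p))
      carry ls (true ∷ bs) {pad} p h k =
        move scan _ _ (cells-facing ls (true ∷ bs) p h) refl
          (go-right false ls (just true) (map just bs ++ pad))
          (carry (false ∷ ls) bs p (shift ls (length bs) h) k)

    inc-tree : ∀ bs {pad n} → Padding pad → 2 + length bs ≤ W →
               (∀ pad′ → Padding pad′ → At (l′ , ready) (counter (increment bs) pad′) n) →
               At (l , ready) (counter bs pad) n
    inc-tree bs {pad} p h k =
      move ready _ _ (≤-trans (cells-counter bs p) h) refl (leave-home (map just bs ++ pad))
        (carry [] bs p h k)

  module _ {l : Label} {j : Fin #counters} {l⁺ l⁰ : Label} (code-l : code l ≡ dec j l⁺ l⁰)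
    {W : ℕ} (i : Tape InputSymbol) {ws : Vec (Tape Cell) #counters} (ws-fit : Fits W ws) where
    open OnTape l j (decStep l l⁺ l⁰) (λ ph σ ss → cong (λ c → exec l c ph σ ss) code-l) W i ws ws-fit

    private
      rewind : ∀ ls bs pad {n} → suc (length ls + length (map just bs ++ pad)) ≤ W →
               At (l⁺ , ready) (counter (ls ʳ++ bs) pad) n →
               At (l , return) (behind ls (map just bs ++ pad)) n
      rewind ls bs pad h T₁ = sweep-back return l⁺ (λ b → b) (λ _ → refl) refl ls bs pad h
        (subst (λ ds → At _ (counter (ds ʳ++ bs) pad) _) (sym (map-id ls)) T₁)

      borrow : ∀ ls bs {pad m n} → Padding pad → 2 + (length ls + length bs) ≤ W → value bs ≡ suc m →
               At (l⁺ , ready) (counter (ls ʳ++ decrement bs) pad) n →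
               At (l , scan) (facing ls (map just bs ++ pad)) n
      borrow ls (true ∷ bs) {pad} p h v T₁ =
        move scan _ _ (cells-facing ls (true ∷ bs) p h) refl refl
          (rewind (false ∷ ls) bs pad (cells-rest ls bs p h) T₁)
      borrow ls (false ∷ bs) {pad} p h v T₁ with value bs in e
      ... | suc _ = move scan _ _ (cells-facing ls (false ∷ bs) p h) refl
          (go-right true ls (just false) (map just bs ++ pad))
          (borrow (true ∷ ls) bs p (shift ls (length bs) h) e T₁)

      exhaust : ∀ ls bs {pad n} → Padding pad → 2 + (length ls + length bs) ≤ W → value bs ≡ 0 →
                At (l⁰ , ready) (counter (map (const false) ls ʳ++ bs) (nothing ∷ [])) n →
                At (l , scan) (facing ls (map just bs ++ pad)) n
      exhaust ls (false ∷ bs) {pad} p h v T₁ =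
        move scan _ _ (cells-facing ls (false ∷ bs) p h) refl
          (go-right true ls (just false) (map just bs ++ pad))
          (exhaust (true ∷ ls) bs p (shift ls (length bs) h) (m+n≡0⇒m≡0 (value bs) v) T₁)
      exhaust ls [] {pad} p h v T₁ = at-end pad p
        where
        back : At (l , restore) (behind ls (nothing ∷ [])) _
        back = sweep-back restore l⁰ (const false) (λ _ → refl) refl ls [] (nothing ∷ [])
          (≤-trans (s≤s (≤-reflexive (+-suc (length ls) 0))) h) T₁
        at-end : ∀ pad → Padding pad → At (l , scan) (facing ls pad) _
        at-end _ p@(inj₁ refl) =
          move scan _ _ (cells-facing ls [] p h) refl (go-left nothing ls nothing []) back
        at-end _ p@(inj₂ refl) =
          move scan _ _ (cells-facing ls [] p h) refl (go-left nothing ls nothing []) back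

    dec-tree⁺ : ∀ bs {pad m n} → Padding pad → 2 + length bs ≤ W → value bs ≡ suc m →
                At (l⁺ , ready) (counter (decrement bs) pad) n → At (l , ready) (counter bs pad) n
    dec-tree⁺ bs {pad} p h v T₁ =
      move ready _ _ (≤-trans (cells-counter bs p) h) refl (leave-home (map just bs ++ pad))
        (borrow [] bs p h v T₁)

    dec-tree⁰ : ∀ bs {pad n} → Padding pad → 2 + length bs ≤ W → value bs ≡ 0 →
                At (l⁰ , ready) (counter bs (nothing ∷ [])) n → At (l , ready) (counter bs pad) n
    dec-tree⁰ bs {pad} p h v T₁ =
      move ready _ _ (≤-trans (cells-counter bs p) h) refl (leave-home (map just bs ++ pad))
        (exhaust [] bs p h v T₁)

  -- `Runs V l i v n`: started at label l with input tape i and counter values v, the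
  -- program has exactly n accepting paths, in space for counter values up to V.
  -- The rules below are the semantics of the instructions at this level.
  Runs : ℕ → Label → Tape InputSymbol → Vec ℕ #counters → ℕ → Set
  Runs V l i v n = ∀ {ws} → Pointwise (Holds V) ws v →
                   Tree (#counters * width V) (config (l , ready) i ws) n

  holds-fits : ∀ {V k} {ws : Vec (Tape Cell) k} {v : Vec ℕ k} →
               Pointwise (Holds V) ws v → Fits (width V) ws
  holds-fits []                                = []
  holds-fits {V} (holds bs pad p refl _ h ∷ hs) =
    ≤-trans (cells-counter bs p) (fits V bs h) ∷ holds-fits hs

  holds-update : ∀ {V k t} (f : ℕ → ℕ) {ws : Vec (Tape Cell) k} {v : Vec ℕ k} j →
                 Holds V t (f (lookup v j)) →
                 Pointwise (Holds V) ws v → Pointwise (Holds V) (ws [ j ]≔ t) (updateAt v j f)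
  holds-update f zero    h (_ ∷ hs)  = h ∷ hs
  holds-update f (suc j) h (h′ ∷ hs) = h′ ∷ holds-update f j h hs

  restored : ∀ {k t} {ws : Vec (Tape Cell) k} {j} → lookup ws j ≡ t → ws [ j ]≔ t ≡ ws
  restored {ws = ws} {j} refl = []≔-lookup ws j

  module _ {V : ℕ} {l : Label} {i : Tape InputSymbol} {v : Vec ℕ #counters} where

    runs-inc : ∀ {j l′ n} → code l ≡ inc j l′ → suc (lookup v j) ≤ V →
               Runs V l′ i (updateAt v j suc) n → Runs V l i v n
    runs-inc {j} {l′} {n} code-l bounded k {ws} hs with Pointwise.lookup hs j
    ... | holds bs pad p t≡ v≡ h =
      subst (λ ws → Tree _ (config (l , ready) i ws) n) (restored t≡)
        (inc-tree code-l i (holds-fits hs) bs p (fits V bs h) λ pad′ p′ →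
          k (holds-update suc j (holds (increment bs) pad′ p′ refl v⁺ (small (length-increment bs))) hs))
      where
      v⁺ : value (increment bs) ≡ suc (lookup v j)
      v⁺ = trans (value-increment bs) (cong suc v≡)
      small : length (increment bs) ≡ length bs ⊎ 2 ^ length (increment bs) ≡ 2 * value (increment bs) →
              2 ^ length (increment bs) ≤ 2 * V
      small (inj₁ e) = subst (λ k → 2 ^ k ≤ 2 * V) (sym e) h
      small (inj₂ e) = subst (_≤ 2 * V) (sym e) (*-monoʳ-≤ 2 (subst (_≤ V) (sym v⁺) bounded))

    runs-dec⁺ : ∀ {j l⁺ l⁰ m n} → code l ≡ dec j l⁺ l⁰ → lookup v j ≡ suc m →
                Runs V l⁺ i (v [ j ]≔ m) n → Runs V l i v n
    runs-dec⁺ {j} {l⁺} {l⁰} {m} {n} code-l v≡suc k {ws} hs with Pointwise.lookup hs j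
    ... | holds bs pad p t≡ v≡ h =
      subst (λ ws → Tree _ (config (l , ready) i ws) n) (restored t≡)
        (dec-tree⁺ code-l i (holds-fits hs) bs p (fits V bs h) (trans v≡ v≡suc)
          (k (holds-update (const m) j
            (holds (decrement bs) pad p refl (value-decrement bs (trans v≡ v≡suc))
              (subst (λ k → 2 ^ k ≤ 2 * V) (sym (length-decrement bs)) h)) hs)))

    runs-dec⁰ : ∀ {j l⁺ l⁰ n} → code l ≡ dec j l⁺ l⁰ → lookup v j ≡ 0 →
                Runs V l⁰ i v n → Runs V l i v n
    runs-dec⁰ {j} {l⁺} {l⁰} {n} code-l v≡0 k {ws} hs with Pointwise.lookup hs j
    ... | holds bs pad p t≡ v≡ h =
      subst (λ ws → Tree _ (config (l , ready) i ws) n) (restored t≡)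
        (dec-tree⁰ code-l i (holds-fits hs) bs p (fits V bs h) (trans v≡ v≡0)
          (k (subst (Pointwise (Holds V) _) (updateAt-id j v)
            (holds-update id j (holds bs (nothing ∷ []) (inj₂ refl) refl v≡ h) hs))))

    private
      at-label : ∀ {c} {ws : Vec (Tape Cell) #counters} → code l ≡ c →
                 enabled (config (l , ready) i ws) ≡ exec l c ready (scanned i) (Vec.map scanned ws)
      at-label {ws = ws} = cong (λ c → exec l c ready (scanned i) (Vec.map scanned ws))

    runs-read : ∀ {f n} → code l ≡ read f →
                Runs V (proj₂ (f (scanned i))) (moveWithin (proj₁ (f (scanned i))) i) v n →
                Runs V l i v n
    runs-read {f} code-l k {ws} hs =
      single (sum-cells (holds-fits hs)) (at-label code-l)
        (subst (λ ws → Tree _ (config _ _ ws) _) (sym (act-idle ws)) (k hs))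

    runs-choose : ∀ {l₁ l₂ l₁≢l₂ m n} → code l ≡ choose l₁ l₂ l₁≢l₂ →
                  Runs V l₁ i v m → Runs V l₂ i v n → Runs V l i v (m + n)
    runs-choose code-l k₁ k₂ {ws} hs =
      fork (sum-cells (holds-fits hs)) (at-label code-l)
        (subst (λ ws → Tree _ (config _ _ ws) _) (sym (act-idle ws)) (k₁ hs))
        (subst (λ ws → Tree _ (config _ _ ws) _) (sym (act-idle ws)) (k₂ hs))

    runs-stop : ∀ {b} → code l ≡ stop b → Runs V l i v (if b then 1 else 0)
    runs-stop code-l {ws} hs =
      subst (λ c → Tree (#counters * width V) (config (l , ready) i ws) (if verdict c then 1 else 0))
        code-l
        (leaf {c = config (l , ready) i ws} (sum-cells (holds-fits hs)) (at-label code-l))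

  -- The factor 5 absorbs the additive constant, since the logarithm is at least 1.
  width-log : ∀ N → 2 ≤ N → width (suc N) ≤ 5 * ⌊log₂ N ⌋
  width-log N@(suc _) 2≤N = begin
    2 + ⌊log₂ (2 * suc N) ⌋       ≤⟨ +-monoʳ-≤ 2 (⌊log₂⌋-mono-≤ (*-monoʳ-≤ 2 suc≤double)) ⟩
    2 + ⌊log₂ (2 * (2 * N)) ⌋     ≡⟨ cong (_+_ 2) (⌊log₂[2*b]⌋≡1+⌊log₂b⌋ (2 * N)) ⟩
    3 + ⌊log₂ (2 * N) ⌋           ≡⟨ cong (_+_ 3) (⌊log₂[2*b]⌋≡1+⌊log₂b⌋ N) ⟩
    4 + ⌊log₂ N ⌋                 ≤⟨ +-monoˡ-≤ ⌊log₂ N ⌋ (*-monoʳ-≤ 4 (⌊log₂⌋-mono-≤ 2≤N)) ⟩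
    4 * ⌊log₂ N ⌋ + ⌊log₂ N ⌋     ≡⟨ +-comm (4 * ⌊log₂ N ⌋) _ ⟩
    5 * ⌊log₂ N ⌋                 ∎
    where
    open ≤-Reasoning
    suc≤double : suc N ≤ 2 * N
    suc≤double = ≤-trans (+-monoˡ-≤ N (s≤s z≤n)) (≤-reflexive (cong (_+_ N) (sym (+-identityʳ N))))

  initially : ∀ {V} k → 1 ≤ V →
              Pointwise (Holds V) (Vec.replicate k (tape [] nothing [])) (Vec.replicate k 0)
  initially zero    1≤V = []
  initially (suc k) 1≤V = holds [] [] (inj₁ refl) refl refl (≤-trans 1≤V (m≤m+n _ _)) ∷ initially k 1≤V

  -- A program whose counters never exceed |x| + 1 counts a function in #L.
  program-∈#L : ∀ f →
                (∀ x → Runs (suc (length x)) entry (inputTape x) (Vec.replicate #counters 0) (f x)) →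
                f ∈#L
  program-∈#L f runs =
    machine , (λ x → tree⇒halts (tree x)) , (#counters * 5 , 2 , space) , λ x → tree⇒paths (tree x)
    where
    tree : ∀ x → Tree (#counters * width (suc (length x))) (initial x) (f x)
    tree x = runs x (initially #counters (s≤s z≤n))
    space : ∀ x → 2 ≤ length x → ∀ c → Star (NTM._⟶_ machine) (initial x) c →
            workSpace c ≤ #counters * 5 * ⌊log₂ length x ⌋
    space x 2≤x c p = ≤-trans (tree⇒space (tree x) p)
      (≤-trans (*-monoʳ-≤ #counters (width-log (length x) 2≤x))
        (≤-reflexive (sym (*-assoc #counters 5 _))))

-- Recurrences for the two differences

open ≡-Reasoning

-- Binomial coefficients by Pascal's rule.
choices : ℕ → ℕ → ℕ
choices _       zero    = 1
choices zero    (suc k) = 0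
choices (suc n) (suc k) = choices n k + choices n (suc k)

-- The number of multisets with k elements from m values.
multichoices : ℕ → ℕ → ℕ
multichoices _       zero    = 1
multichoices zero    (suc k) = 0
multichoices (suc m) (suc k) = multichoices (suc m) k + multichoices m (suc k)

choices≡C : ∀ n k → choices n k ≡ n C k
choices≡C n       zero    = sym (trans (nCk≡nC[n∸k] {0} {n} z≤n) (nCn≡1 n))
choices≡C zero    (suc k) = sym (k>n⇒nCk≡0 {0} {suc k} (s≤s z≤n))
choices≡C (suc n) (suc k) =
  trans (cong₂ _+_ (choices≡C n k) (choices≡C n (suc k))) (nCk+nC[k+1]≡[n+1]C[k+1] n k)

multichoices≡C : ∀ n k → multichoices (suc n) k ≡ (n + k) C n
multichoices≡C n       zero    = sym (trans (cong (_C n) (+-identityʳ n)) (nCn≡1 n))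
multichoices≡C zero    (suc k) = trans (+-identityʳ _)
  (trans (multichoices≡C zero k) (trans (sym (choices≡C k 0)) (choices≡C (suc k) 0)))
multichoices≡C (suc n) (suc k) = begin
  multichoices (2 + n) k + multichoices (suc n) (suc k)
    ≡⟨ cong₂ _+_ (multichoices≡C (suc n) k) (multichoices≡C n (suc k)) ⟩
  (suc n + k) C suc n + (n + suc k) C n                 ≡⟨ +-comm ((suc n + k) C suc n) _ ⟩
  (n + suc k) C n + (suc n + k) C suc n
    ≡⟨ cong (λ m → (n + suc k) C n + m C suc n) (sym (+-suc n k)) ⟩
  (n + suc k) C n + (n + suc k) C suc n                 ≡⟨ nCk+nC[k+1]≡[n+1]C[k+1] (n + suc k) n ⟩
  (suc n + suc k) C suc n                               ∎

-- g (k - 1), and 0 for k = 0; with it Pascal's rule holds also at k = 0.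
shifted : (ℕ → ℕ) → ℕ → ℕ
shifted g zero    = 0
shifted g (suc k) = g k

choices-pascal : ∀ n k → choices (suc n) k ≡ shifted (choices n) k + choices n k
choices-pascal n zero    = refl
choices-pascal n (suc k) = refl

shifted-choices-pascal : ∀ n k →
  shifted (choices (suc n)) k ≡ shifted (shifted (choices n)) k + shifted (choices n) k
shifted-choices-pascal n zero    = refl
shifted-choices-pascal n (suc k) = choices-pascal n k

multichoices-pascal : ∀ m k →
  multichoices (suc m) k ≡ shifted (multichoices (suc m)) k + multichoices m k
multichoices-pascal m zero    = refl
multichoices-pascal m (suc k) = refl

-- The number of ways to complete a pair when no element of the ground set is left.
bothZero : ℕ → ℕ → ℕ
bothZero zero    zero    = 1
bothZero zero    (suc d) = 0
bothZero (suc a) d       = 0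

-- The pairs (S , U) of subsets of [n] with |S| = a and |U| = a + d such that no
-- initial segment of [n] has more elements in S than in U, classified by where
-- the last element of [n] lies: in S (inFirst), in neither set, or in U only
-- (inSecond).
mutual
  subsetPairs : ℕ → ℕ → ℕ → ℕ
  subsetPairs zero    a d = bothZero a d
  subsetPairs (suc n) a d = inFirst n a d + (subsetPairs n a d + inSecond n a d)

  inFirst : ℕ → ℕ → ℕ → ℕ
  inFirst n zero    d = 0
  inFirst n (suc a) d = subsetPairs n a d + subsetPairs n a (suc d)

  inSecond : ℕ → ℕ → ℕ → ℕ
  inSecond n a zero    = 0
  inSecond n a (suc d) = subsetPairs n a d

add-two : ∀ w w′ {x y x′ y′} → w + x ≡ y → w′ + x′ ≡ y′ → w + w′ + (x + x′) ≡ y + y′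
add-two w w′ {x} {x′ = x′} e e′ = trans (regroup w w′ x x′) (cong₂ _+_ e e′)
  where
  regroup : ∀ w w′ x x′ → w + w′ + (x + x′) ≡ w + x + (w′ + x′)
  regroup = solve-∀

-- The three formulas mirror the cases of the recurrence.  Each is stated with the
-- subtracted product moved to the left-hand side, so that they can be added up and
-- reassembled by Pascal's rule.
subsetPairs-formula : ∀ n a d → subsetPairs n a d + shifted (choices n) a * choices n (suc (a + d)) ≡
                                choices n a * choices n (a + d)
inFirst-formula : ∀ n a d →
  inFirst n a d + shifted (shifted (choices n)) a * (choices n (a + d) + choices n (suc (a + d))) ≡
  shifted (choices n) a * (shifted (choices n) (a + d) + choices n (a + d))
inSecond-formula : ∀ n a d → inSecond n a d + shifted (choices n) a * choices n (a + d) ≡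
                             choices n a * shifted (choices n) (a + d)

subsetPairs-formula zero    zero    zero    = refl
subsetPairs-formula zero    zero    (suc d) = refl
subsetPairs-formula zero    (suc a) d       = *-zeroʳ (choices 0 a)
subsetPairs-formula (suc n) a d = begin
  inFirst n a d + (subsetPairs n a d + inSecond n a d) + shifted (choices (suc n)) a * (c + c⁺)
    ≡⟨ cong (λ p → inFirst n a d + (subsetPairs n a d + inSecond n a d) + p * (c + c⁺))
         (shifted-choices-pascal n a) ⟩
  inFirst n a d + (subsetPairs n a d + inSecond n a d) + (a₂ + a₁) * (c + c⁺)
    ≡⟨ split-up (inFirst n a d) (subsetPairs n a d) (inSecond n a d) a₂ a₁ c c⁺ ⟩
  inFirst n a d + (subsetPairs n a d + inSecond n a d) + (a₂ * (c + c⁺) + (a₁ * c⁺ + a₁ * c))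
    ≡⟨ add-two (inFirst n a d) _ (inFirst-formula n a d)
         (add-two (subsetPairs n a d) (inSecond n a d)
           (subsetPairs-formula n a d) (inSecond-formula n a d)) ⟩
  a₁ * (c⁻ + c) + (a₀ * c + a₀ * c⁻)
    ≡⟨ collect a₁ a₀ c⁻ c ⟩
  (a₁ + a₀) * (c⁻ + c)
    ≡⟨ sym (cong₂ _*_ (choices-pascal n a) (choices-pascal n (a + d))) ⟩
  choices (suc n) a * choices (suc n) (a + d) ∎
  where
  a₂ a₁ a₀ c⁻ c c⁺ : ℕ
  a₂ = shifted (shifted (choices n)) a
  a₁ = shifted (choices n) a
  a₀ = choices n a
  c⁻ = shifted (choices n) (a + d)
  c  = choices n (a + d)
  c⁺ = choices n (suc (a + d))
  split-up : ∀ x y z a₂ a₁ c c⁺ → x + (y + z) + (a₂ + a₁) * (c + c⁺) ≡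
                                  x + (y + z) + (a₂ * (c + c⁺) + (a₁ * c⁺ + a₁ * c))
  split-up = solve-∀
  collect : ∀ a₁ a₀ c⁻ c → a₁ * (c⁻ + c) + (a₀ * c + a₀ * c⁻) ≡ (a₁ + a₀) * (c⁻ + c)
  collect = solve-∀

inFirst-formula n zero    d = refl
inFirst-formula n (suc a) d = begin
  subsetPairs n a d + subsetPairs n a (suc d) + a₁ * (choices n (suc (a + d)) + choices n (suc (suc (a + d))))
    ≡⟨ cong (λ m → subsetPairs n a d + subsetPairs n a (suc d) + a₁ * (choices n (suc (a + d)) + choices n (suc m)))
         (sym (+-suc a d)) ⟩
  subsetPairs n a d + subsetPairs n a (suc d) + a₁ * (choices n (suc (a + d)) + choices n (suc (a + suc d)))
    ≡⟨ cong (_+_ (subsetPairs n a d + subsetPairs n a (suc d))) (*-distribˡ-+ a₁ _ _) ⟩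
  subsetPairs n a d + subsetPairs n a (suc d) + (a₁ * choices n (suc (a + d)) + a₁ * choices n (suc (a + suc d)))
    ≡⟨ add-two (subsetPairs n a d) (subsetPairs n a (suc d))
         (subsetPairs-formula n a d) (subsetPairs-formula n a (suc d)) ⟩
  choices n a * choices n (a + d) + choices n a * choices n (a + suc d)
    ≡⟨ sym (*-distribˡ-+ (choices n a) _ _) ⟩
  choices n a * (choices n (a + d) + choices n (a + suc d))
    ≡⟨ cong (λ m → choices n a * (choices n (a + d) + choices n m)) (+-suc a d) ⟩
  choices n a * (choices n (a + d) + choices n (suc (a + d))) ∎
  where
  a₁ : ℕ
  a₁ = shifted (choices n) a

-- For d = 0 there is no pair, and both products agree: this is the reflecting boundary.
inSecond-formula n a zero    = trans (cong (λ m → shifted (choices n) a * choices n m) (+-identityʳ a))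
  (trans (*-comm (shifted (choices n) a) (choices n a))
    (cong (λ m → choices n a * shifted (choices n) m) (sym (+-identityʳ a))))
inSecond-formula n a (suc d) = begin
  subsetPairs n a d + shifted (choices n) a * choices n (a + suc d)
    ≡⟨ cong (λ m → subsetPairs n a d + shifted (choices n) a * choices n m) (+-suc a d) ⟩
  subsetPairs n a d + shifted (choices n) a * choices n (suc (a + d)) ≡⟨ subsetPairs-formula n a d ⟩
  choices n a * choices n (a + d)
    ≡⟨ cong (λ m → choices n a * shifted (choices n) m) (sym (+-suc a d)) ⟩
  choices n a * shifted (choices n) (a + suc d) ∎

-- The same for multisets S and U over the values 0, ..., n, scanned from the largest
-- value down.  For each value first its copies in U, the upper row of the
-- tableau, are placed, then those in S, the lower row; afterSecond counts the
-- completions once the copies in U are placed, and afterFirst once those in S are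
-- placed too, which leaves n values.  The excess d may not become negative in
-- between, which says that the columns of the tableau increase strictly.  Each
-- sum has a summand for placing one more copy and one for placing no more; a
-- summand 0 means that another copy is impossible.
mutual
  multisetPairs : ℕ → ℕ → ℕ → ℕ
  multisetPairs n a zero    = 0 + afterSecond n a zero
  multisetPairs n a (suc d) = multisetPairs n a d + afterSecond n a (suc d)

  afterSecond : ℕ → ℕ → ℕ → ℕ
  afterSecond n zero    d = 0 + afterFirst n zero d
  afterSecond n (suc a) d = afterSecond n a (suc d) + afterFirst n (suc a) d

  afterFirst : ℕ → ℕ → ℕ → ℕ
  afterFirst zero    a d = bothZero a d
  afterFirst (suc n) a d = multisetPairs n a d

-- With n values left for one of the sets and n + 1 for the other, the mixed product
-- in afterSecond-formula interpolates between the two pure ones.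
multisetPairs-formula : ∀ n a d →
  multisetPairs n a d + shifted (multichoices (suc n)) a * multichoices (suc n) (suc (a + d)) ≡
  multichoices (suc n) a * multichoices (suc n) (a + d)
afterSecond-formula : ∀ n a d →
  afterSecond n a d + shifted (multichoices (suc n)) a * multichoices n (suc (a + d)) ≡
  multichoices (suc n) a * multichoices n (a + d)
afterFirst-formula : ∀ n a d →
  afterFirst n a d + shifted (multichoices n) a * multichoices n (suc (a + d)) ≡
  multichoices n a * multichoices n (a + d)

-- For d = 0 the term a₀ * a₁ appears on both sides: this is the reflecting boundary.
multisetPairs-formula n a zero rewrite +-identityʳ a = begin
  afterSecond n a 0 + a₁ * (a₀ + m⁺)           ≡⟨ regroup (afterSecond n a 0) a₁ a₀ m⁺ ⟩
  (afterSecond n a 0 + a₁ * m⁺) + a₀ * a₁      ≡⟨ cong (_+ a₀ * a₁) step ⟩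
  a₀ * m + a₀ * a₁                             ≡⟨ collect a₀ m a₁ ⟩
  a₀ * (a₁ + m)                                ≡⟨ cong (a₀ *_) (sym (multichoices-pascal n a)) ⟩
  a₀ * a₀ ∎
  where
  a₁ a₀ m m⁺ : ℕ
  a₁ = shifted (multichoices (suc n)) a
  a₀ = multichoices (suc n) a
  m  = multichoices n a
  m⁺ = multichoices n (suc a)
  step : afterSecond n a 0 + a₁ * m⁺ ≡ a₀ * m
  step = subst (λ k → afterSecond n a 0 + a₁ * multichoices n (suc k) ≡ a₀ * multichoices n k)
    (+-identityʳ a) (afterSecond-formula n a 0)
  regroup : ∀ s a₁ a₀ m⁺ → s + a₁ * (a₀ + m⁺) ≡ (s + a₁ * m⁺) + a₀ * a₁
  regroup = solve-∀
  collect : ∀ a₀ m a₁ → a₀ * m + a₀ * a₁ ≡ a₀ * (a₁ + m)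
  collect = solve-∀
multisetPairs-formula n a (suc d) = begin
  multisetPairs n a d + afterSecond n a (suc d) + a₁ * (multichoices (suc n) (a + suc d) + m⁺)
    ≡⟨ cong (_+_ (multisetPairs n a d + afterSecond n a (suc d))) (*-distribˡ-+ a₁ _ m⁺) ⟩
  multisetPairs n a d + afterSecond n a (suc d) + (a₁ * multichoices (suc n) (a + suc d) + a₁ * m⁺)
    ≡⟨ cong (λ k → multisetPairs n a d + afterSecond n a (suc d) + (a₁ * multichoices (suc n) k + a₁ * m⁺))
         (+-suc a d) ⟩
  multisetPairs n a d + afterSecond n a (suc d) + (a₁ * multichoices (suc n) (suc (a + d)) + a₁ * m⁺)
    ≡⟨ add-two (multisetPairs n a d) (afterSecond n a (suc d))
         (multisetPairs-formula n a d) (afterSecond-formula n a (suc d)) ⟩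
  a₀ * multichoices (suc n) (a + d) + a₀ * multichoices n (a + suc d)
    ≡⟨ sym (*-distribˡ-+ a₀ _ _) ⟩
  a₀ * (multichoices (suc n) (a + d) + multichoices n (a + suc d))
    ≡⟨ cong (λ k → a₀ * (multichoices (suc n) (a + d) + multichoices n k)) (+-suc a d) ⟩
  a₀ * multichoices (suc n) (suc (a + d))
    ≡⟨ cong (λ k → a₀ * multichoices (suc n) k) (sym (+-suc a d)) ⟩
  a₀ * multichoices (suc n) (a + suc d) ∎
  where
  a₁ a₀ m⁺ : ℕ
  a₁ = shifted (multichoices (suc n)) a
  a₀ = multichoices (suc n) a
  m⁺ = multichoices n (suc (a + suc d))

afterSecond-formula n zero    d = afterFirst-formula n zero d
afterSecond-formula n (suc a) d = begin
  afterSecond n a (suc d) + afterFirst n (suc a) d + multichoices (suc n) a * m⁺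
    ≡⟨ cong (λ k → afterSecond n a (suc d) + afterFirst n (suc a) d + k * m⁺) (multichoices-pascal n a) ⟩
  afterSecond n a (suc d) + afterFirst n (suc a) d + (shifted (multichoices (suc n)) a + multichoices n a) * m⁺
    ≡⟨ cong (_+_ (afterSecond n a (suc d) + afterFirst n (suc a) d))
         (*-distribʳ-+ m⁺ (shifted (multichoices (suc n)) a) _) ⟩
  afterSecond n a (suc d) + afterFirst n (suc a) d + (shifted (multichoices (suc n)) a * m⁺ + multichoices n a * m⁺)
    ≡⟨ add-two (afterSecond n a (suc d)) (afterFirst n (suc a) d) step (afterFirst-formula n (suc a) d) ⟩
  multichoices (suc n) a * m + multichoices n (suc a) * m
    ≡⟨ sym (*-distribʳ-+ m (multichoices (suc n) a) _) ⟩
  multichoices (suc n) (suc a) * m ∎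
  where
  m m⁺ : ℕ
  m  = multichoices n (suc (a + d))
  m⁺ = multichoices n (suc (suc (a + d)))
  step : afterSecond n a (suc d) + shifted (multichoices (suc n)) a * m⁺ ≡ multichoices (suc n) a * m
  step = subst (λ k → afterSecond n a (suc d) + shifted (multichoices (suc n)) a * multichoices n (suc k) ≡
                      multichoices (suc n) a * multichoices n k)
    (+-suc a d) (afterSecond-formula n a (suc d))

afterFirst-formula zero    zero    zero    = refl
afterFirst-formula zero    zero    (suc d) = refl
afterFirst-formula zero    (suc a) d       = *-zeroʳ (multichoices 0 a)
afterFirst-formula (suc n) a       d       = multisetPairs-formula n a d

+≡⇒≡⊖ : ∀ {m k n} → m + k ≡ n → + m ≡ n ⊖ k
+≡⇒≡⊖ {m} {k} refl = sym (trans (⊖-≥ (m≤n+m k m)) (cong +_ (m+n∸n≡m m k)))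

subsetPairs-difference : ∀ n a b → 1 ≤ a → a ≤ b →
  + subsetPairs n a (b ∸ a) ≡ ((n C a) * (n C b)) ⊖ ((n C (a ∸ 1)) * (n C (b + 1)))
subsetPairs-difference n a@(suc a′) b _ a≤b = +≡⇒≡⊖ (begin
  subsetPairs n a (b ∸ a) + (n C a′) * (n C (b + 1))
    ≡⟨ cong (_+_ (subsetPairs n a (b ∸ a))) (cong₂ _*_ (sym (choices≡C n a′)) upper) ⟩
  subsetPairs n a (b ∸ a) + choices n a′ * choices n (suc (a + (b ∸ a)))
    ≡⟨ subsetPairs-formula n a (b ∸ a) ⟩
  choices n a * choices n (a + (b ∸ a))
    ≡⟨ cong₂ _*_ (choices≡C n a) (trans (cong (choices n) a+d≡b) (choices≡C n b)) ⟩
  (n C a) * (n C b) ∎)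
  where
  a+d≡b : a + (b ∸ a) ≡ b
  a+d≡b = m+[n∸m]≡n a≤b
  upper : n C (b + 1) ≡ choices n (suc (a + (b ∸ a)))
  upper = trans (sym (choices≡C n (b + 1)))
    (cong (choices n) (trans (+-comm b 1) (cong suc (sym a+d≡b))))

multisetPairs-difference : ∀ n a b → 1 ≤ a → a ≤ b →
  + multisetPairs n a (b ∸ a) ≡
  (((n + a) C n) * ((n + b) C n)) ⊖ (((n + a ∸ 1) C n) * ((n + b + 1) C n))
multisetPairs-difference n a@(suc a′) b _ a≤b = +≡⇒≡⊖ (begin
  multisetPairs n a (b ∸ a) + ((n + a ∸ 1) C n) * ((n + b + 1) C n)
    ≡⟨ cong (_+_ (multisetPairs n a (b ∸ a))) (cong₂ _*_ lower upper) ⟩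
  multisetPairs n a (b ∸ a) + multichoices (suc n) a′ * multichoices (suc n) (suc (a + (b ∸ a)))
    ≡⟨ multisetPairs-formula n a (b ∸ a) ⟩
  multichoices (suc n) a * multichoices (suc n) (a + (b ∸ a))
    ≡⟨ cong₂ _*_ (multichoices≡C n a) (trans (cong (multichoices (suc n)) a+d≡b) (multichoices≡C n b)) ⟩
  ((n + a) C n) * ((n + b) C n) ∎)
  where
  a+d≡b : a + (b ∸ a) ≡ b
  a+d≡b = m+[n∸m]≡n a≤b
  lower : (n + a ∸ 1) C n ≡ multichoices (suc n) a′
  lower = trans (cong (λ k → (k ∸ 1) C n) (+-suc n a′)) (sym (multichoices≡C n a′))
  upper : (n + b + 1) C n ≡ multichoices (suc n) (suc (a + (b ∸ a)))
  upper = trans (cong (_C n) (trans (+-assoc n b 1) (cong (_+_ n) (trans (+-comm b 1) (cong suc (sym a+d≡b))))))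
    (sym (multichoices≡C n _))

-- The counter programs

-- Labels of the checking pass, the loading pass, the final test, and the g labels of
-- the guessing phase.
Label : ℕ → Set
Label g = Fin 7 ⊎ Fin 5 ⊎ Fin 4 ⊎ Fin g

Label-finite : ∀ g → Label g ↔ Fin (7 + (5 + (4 + g)))
Label-finite g = ↔-sym (+↔⊎ {7}) ↔-∘ (↔-id (Fin 7) ⊎-↔
                (↔-sym (+↔⊎ {5}) ↔-∘ (↔-id (Fin 5) ⊎-↔ ↔-sym (+↔⊎ {4}))))

-- Rightwards: checkN passes over the first block, counting it in #B; checkA₁ and checkA
-- pass over the second one, which must not be empty; checkB passes over the third one,
-- which must not exceed the count.
pattern start   = inj₁ 0F
pattern checkN  = inj₁ 1F
pattern countN  = inj₁ 2F
pattern checkA₁ = inj₁ 3F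
pattern checkA  = inj₁ 4F
pattern checkB  = inj₁ 5F
pattern countB  = inj₁ 6F

-- Leftwards: loadB counts the third block in #D; loadA counts the second one in #A and
-- subtracts it from #D.
pattern loadB  = inj₂ (inj₁ 0F)
pattern raiseD = inj₂ (inj₁ 1F)
pattern loadA  = inj₂ (inj₁ 2F)
pattern lowerD = inj₂ (inj₁ 3F)
pattern raiseA = inj₂ (inj₁ 4F)

pattern finalA    = inj₂ (inj₂ (inj₁ 0F))
pattern finalD    = inj₂ (inj₂ (inj₁ 1F))
pattern accepting = inj₂ (inj₂ (inj₁ 2F))
pattern rejecting = inj₂ (inj₂ (inj₁ 3F))

pattern guess k = inj₂ (inj₂ (inj₂ k))

-- #A holds a, the elements of the first set still to be placed, and #D the excess of
-- the second set; #B serves only to check b ≤ n.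
pattern #A = 0F
pattern #D = 1F
pattern #B = 2F

onSymbol : {X : Set} (leftEnd one zero rightEnd : X) → InputSymbol → X
onSymbol l o z r ⊢           = l
onSymbol l o z r (bit true)  = o
onSymbol l o z r (bit false) = z
onSymbol l o z r ⊣           = r

reject : ∀ {g} → Move × Label g
reject = stay , rejecting

-- The instructions of a guessing phase.
Guessing : ℕ → Set
Guessing g = Fin (suc g) → Instruction (Label (suc g)) 3

-- The phase γ is entered at its label 0, with the head on the last symbol of the first
-- block, or on the left end marker if that block is empty.
code : ∀ {g} → Guessing g → Label (suc g) → Instruction (Label (suc g)) 3
code γ start     = read (onSymbol (right , checkN) reject reject reject)
code γ checkN    = read (onSymbol reject (right , countN) (right , checkA₁) reject)
code γ countN    = inc #B checkN
code γ checkA₁   = read (onSymbol reject (right , checkA) reject reject)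
code γ checkA    = read (onSymbol reject (right , checkA) (right , checkB) reject)
code γ checkB    = read (onSymbol reject (right , countB) reject (left , loadB))
code γ countB    = dec #B checkB rejecting
code γ loadB     = read (onSymbol reject (left , raiseD) (left , loadA) reject)
code γ raiseD    = inc #D loadB
code γ loadA     = read (onSymbol reject (left , lowerD) (left , guess 0F) reject)
code γ lowerD    = dec #D raiseA rejecting
code γ raiseA    = inc #A loadA
code γ finalA    = dec #A rejecting finalD
code γ finalD    = dec #D rejecting accepting
code γ accepting = stop true
code γ rejecting = stop false
code γ (guess k) = γ k

program : ∀ {g} → Guessing g → Program
program {g} γ = record
  { Label = Label (suc g) ; #labels = 7 + (5 + (4 + suc g)) ; Label-finite = Label-finite (suc g)
  ; #counters = 3 ; entry = start ; code = code γ }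

-- Guessing a pair of subsets: each symbol 1 stands for one element of [n], which is put
-- into the first set or not (chooseFirst), then into the second set or not
-- (chooseSecond, or chooseSecond′ if it is not in the first set).
pattern nextElement   = guess 0F
pattern chooseFirst   = guess 1F
pattern takeFirst     = guess 2F
pattern chooseSecond  = guess 3F
pattern chooseSecond′ = guess 4F
pattern onlyFirst     = guess 5F
pattern onlySecond    = guess 6F

subsetGuess : Guessing 6
subsetGuess 0F = read (onSymbol (stay , finalA) (left , chooseFirst) reject reject)
subsetGuess 1F = choose takeFirst chooseSecond′ λ ()
subsetGuess 2F = dec #A chooseSecond rejecting
subsetGuess 3F = choose nextElement onlyFirst λ ()
subsetGuess 4F = choose nextElement onlySecond λ ()
subsetGuess 5F = inc #D nextElement
subsetGuess 6F = dec #D nextElement rejecting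

-- Guessing a pair of multisets: each copy of the current value in U (takeUpper) lowers
-- the excess, each copy in S (takeLower, widen) lowers #A and raises the excess;
-- nextValue moves on by one symbol 1.  There are n + 1 values, as a value is also
-- treated at the left end marker.  Both loops are bounded by the counters.
pattern chooseUpper = guess 0F
pattern takeUpper   = guess 1F
pattern chooseLower = guess 2F
pattern takeLower   = guess 3F
pattern widen       = guess 4F
pattern nextValue   = guess 5F

multisetGuess : Guessing 5
multisetGuess 0F = choose takeUpper chooseLower λ ()
multisetGuess 1F = dec #D chooseUpper rejecting
multisetGuess 2F = choose takeLower nextValue λ ()
multisetGuess 3F = dec #A widen rejecting
multisetGuess 4F = inc #D chooseLower
multisetGuess 5F = read (onSymbol (stay , finalA) (left , chooseUpper) reject reject)

pattern 𝟏 = bit true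
pattern 𝟎 = bit false

-- The input tape from the first symbol of x on.
symbols : List Bool → List InputSymbol
symbols x = map bit x ++ ⊣ ∷ []

block : ℕ → List InputSymbol
block k = replicate k 𝟏

ones-≤-length : ∀ k {y} → k ≤ length (ones k ++ y)
ones-≤-length zero    = z≤n
ones-≤-length (suc k) = s≤s (ones-≤-length k)

symbols-ones : ∀ k → symbols (ones k) ≡ block k ++ ⊣ ∷ []
symbols-ones zero    = refl
symbols-ones (suc k) = cong (𝟏 ∷_) (symbols-ones k)

symbols-block : ∀ k y → symbols (ones k ++ false ∷ y) ≡ block k ++ 𝟎 ∷ symbols y
symbols-block zero    y = refl
symbols-block (suc k) y = cong (𝟏 ∷_) (symbols-block k y)

-- The head on the first symbol of the right part (of the left part), the other
-- part being listed from the head outwards.  The empty case is never used.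
rightwards leftwards : List InputSymbol → List InputSymbol → Tape InputSymbol
rightwards ls []       = tape ls ⊣ []
rightwards ls (r ∷ rs) = tape ls r rs
leftwards []       rs = tape [] ⊢ rs
leftwards (l ∷ ls) rs = tape ls l rs

right-block : ∀ ls s k r rs →
              moveWithin right (tape ls s (block k ++ r ∷ rs)) ≡ rightwards (s ∷ ls) (block k ++ r ∷ rs)
right-block ls s zero    r rs = refl
right-block ls s (suc k) r rs = refl

left-block : ∀ k l ls s rs →
             moveWithin left (tape (block k ++ l ∷ ls) s rs) ≡ leftwards (block k ++ l ∷ ls) (s ∷ rs)
left-block zero    l ls s rs = refl
left-block (suc k) l ls s rs = refl

right-symbols : ∀ ls s x → moveWithin right (tape ls s (symbols x)) ≡ rightwards (s ∷ ls) (symbols x)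
right-symbols ls s []      = refl
right-symbols ls s (_ ∷ _) = refl

block-ʳ++ : ∀ k ls → block k ʳ++ ls ≡ block k ++ ls
block-ʳ++ zero    ls = refl
block-ʳ++ (suc k) ls = trans (block-ʳ++ k (𝟏 ∷ ls)) (shift k)
  where
  shift : ∀ k → block k ++ 𝟏 ∷ ls ≡ 𝟏 ∷ block k ++ ls
  shift zero    = refl
  shift (suc k) = cong (𝟏 ∷_) (shift k)

-- Executions of the program with guessing phase γ and counters bounded by V

module Execution {g : ℕ} (γ : Guessing g) (V : ℕ) where
  open Compile (program γ) public

  -- The counters #A, #D and #B hold a, d and b.
  Computes : Label (suc g) → Tape InputSymbol → ℕ → ℕ → ℕ → ℕ → Set
  Computes l i a d b n = Runs V l i (a ∷ d ∷ b ∷ []) n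

  onTapes : ∀ {l i i′ a d b n} → i ≡ i′ → Computes l i′ a d b n → Computes l i a d b n
  onTapes refl k = k

  recast : ∀ {l i a a′ d d′ b b′ n} → a ≡ a′ → d ≡ d′ → b ≡ b′ →
           Computes l i a d b n → Computes l i a′ d′ b′ n
  recast refl refl refl k = k

  rejects : ∀ {i a d b} → Computes rejecting i a d b 0
  rejects = runs-stop refl

  passN : ∀ k ls r rs {a d b n} → k + b ≤ V →
          Computes checkN (rightwards (block k ʳ++ ls) (r ∷ rs)) a d (k + b) n →
          Computes checkN (rightwards ls (block k ++ r ∷ rs)) a d b n
  passN zero    ls r rs h k₁ = k₁
  passN (suc k) ls r rs {b = b} h k₁ =
    runs-read refl (onTapes (right-block ls 𝟏 k r rs)
      (runs-inc refl (≤-trans (s≤s (m≤n+m b k)) h)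
        (passN k (𝟏 ∷ ls) r rs (≤-trans (≤-reflexive (+-suc k b)) h)
          (recast refl refl (sym (+-suc k b)) k₁))))

  passA : ∀ k ls r rs {a d b n} →
          Computes checkA (rightwards (block k ʳ++ ls) (r ∷ rs)) a d b n →
          Computes checkA (rightwards ls (block k ++ r ∷ rs)) a d b n
  passA zero    ls r rs k₁ = k₁
  passA (suc k) ls r rs k₁ =
    runs-read refl (onTapes (right-block ls 𝟏 k r rs) (passA k (𝟏 ∷ ls) r rs k₁))

  passB : ∀ k ls r rs {a d b n} →
          Computes checkB (rightwards (block k ʳ++ ls) (r ∷ rs)) a d b n →
          Computes checkB (rightwards ls (block k ++ r ∷ rs)) a d (k + b) n
  passB zero    ls r rs k₁ = k₁
  passB (suc k) ls r rs k₁ =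
    runs-read refl (onTapes (right-block ls 𝟏 k r rs) (runs-dec⁺ refl refl (passB k (𝟏 ∷ ls) r rs k₁)))

  passB-rejects : ∀ k ls r rs {a d b} → b < k →
                  Computes checkB (rightwards ls (block k ++ r ∷ rs)) a d b 0
  passB-rejects (suc k) ls r rs {b = zero}  _         =
    runs-read refl (onTapes (right-block ls 𝟏 k r rs) (runs-dec⁰ refl refl rejects))
  passB-rejects (suc k) ls r rs {b = suc b} (s≤s b<k) =
    runs-read refl (onTapes (right-block ls 𝟏 k r rs)
      (runs-dec⁺ refl refl (passB-rejects k (𝟏 ∷ ls) r rs b<k)))

  backB : ∀ k l ls rs {a d b n} → k + d ≤ V →
          (∀ rs → Computes loadB (leftwards (l ∷ ls) rs) a (k + d) b n) →
          Computes loadB (leftwards (block k ++ l ∷ ls) rs) a d b n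
  backB zero    l ls rs h k₁ = k₁ rs
  backB (suc k) l ls rs {d = d} h k₁ =
    runs-read refl (onTapes (left-block k l ls 𝟏 rs)
      (runs-inc refl (≤-trans (s≤s (m≤n+m d k)) h)
        (backB k l ls (𝟏 ∷ rs) (≤-trans (≤-reflexive (+-suc k d)) h)
          λ rs → recast refl (sym (+-suc k d)) refl (k₁ rs))))

  backA : ∀ k l ls rs {a d b n} → k + a ≤ V →
          (∀ rs → Computes loadA (leftwards (l ∷ ls) rs) (k + a) d b n) →
          Computes loadA (leftwards (block k ++ l ∷ ls) rs) a (k + d) b n
  backA zero    l ls rs h k₁ = k₁ rs
  backA (suc k) l ls rs {a = a} h k₁ =
    runs-read refl (onTapes (left-block k l ls 𝟏 rs) (runs-dec⁺ refl refl
      (runs-inc refl (≤-trans (s≤s (m≤n+m a k)) h)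
        (backA k l ls (𝟏 ∷ rs) (≤-trans (≤-reflexive (+-suc k a)) h)
          λ rs → recast (sym (+-suc k a)) refl refl (k₁ rs)))))

  backA-rejects : ∀ k l ls rs {a d b} → d + a ≤ V → d < k →
                  Computes loadA (leftwards (block k ++ l ∷ ls) rs) a d b 0
  backA-rejects (suc k) l ls rs {d = zero} h _ =
    runs-read refl (onTapes (left-block k l ls 𝟏 rs) (runs-dec⁰ refl refl rejects))
  backA-rejects (suc k) l ls rs {a = a} {d = suc d} h (s≤s d<k) =
    runs-read refl (onTapes (left-block k l ls 𝟏 rs) (runs-dec⁺ refl refl
      (runs-inc refl (≤-trans (s≤s (m≤n+m a d)) h)
        (backA-rejects k l ls (𝟏 ∷ rs) (≤-trans (≤-reflexive (+-suc d a)) h) d<k))))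

  tests : ∀ {i b} a d → Computes finalA i a d b (bothZero a d)
  tests zero    zero    = runs-dec⁰ refl refl (runs-dec⁰ refl refl (runs-stop refl))
  tests zero    (suc d) = runs-dec⁰ refl refl (runs-dec⁺ refl refl rejects)
  tests (suc a) d       = runs-dec⁺ refl refl rejects

  -- What the head leaves behind it in passing over the first block.
  seen : ℕ → List InputSymbol
  seen n = block n ++ ⊢ ∷ []

  first-block : ∀ n y {m} → n ≤ V → Computes checkA₁ (rightwards (𝟎 ∷ seen n) (symbols y)) 0 0 n m →
                Computes start (inputTape (ones n ++ false ∷ y)) 0 0 0 m
  first-block n y {m} n≤V k =
    runs-read refl (onTapes (right-symbols [] ⊢ (ones n ++ false ∷ y))
      (subst (λ z → Computes checkN (rightwards (⊢ ∷ []) z) 0 0 0 m) (sym (symbols-block n y))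
        (passN n (⊢ ∷ []) 𝟎 (symbols y) (≤-trans (≤-reflexive (+-identityʳ n)) n≤V)
          (recast refl refl (sym (+-identityʳ n))
            (runs-read refl (onTapes (trans (right-symbols (block n ʳ++ ⊢ ∷ []) 𝟎 y)
              (cong (λ ls → rightwards (𝟎 ∷ ls) (symbols y)) (block-ʳ++ n (⊢ ∷ [])))) k))))))

  second-block : ∀ a y ls {b m} →
                 Computes checkB (rightwards (𝟎 ∷ block (suc a) ++ ls) (symbols y)) 0 0 b m →
                 Computes checkA₁ (rightwards ls (symbols (ones (suc a) ++ false ∷ y))) 0 0 b m
  second-block a y ls {b} {m} k =
    subst (λ z → Computes checkA₁ (rightwards ls z) 0 0 b m) (sym (symbols-block (suc a) y))
      (runs-read refl (onTapes (right-block ls 𝟏 a 𝟎 (symbols y))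
        (passA a (𝟏 ∷ ls) 𝟎 (symbols y)
          (runs-read refl (onTapes (trans (right-symbols (block (suc a) ʳ++ ls) 𝟎 y)
            (cong (λ ls → rightwards (𝟎 ∷ ls) (symbols y)) (block-ʳ++ (suc a) ls))) k)))))

  third-block : ∀ b ls l {c m} → b ≤ V → (∀ rs → Computes loadB (leftwards (l ∷ ls) rs) 0 b c m) →
                Computes checkB (rightwards (l ∷ ls) (symbols (ones b))) 0 0 (b + c) m
  third-block b ls l {c} {m} b≤V k =
    subst (λ z → Computes checkB (rightwards (l ∷ ls) z) 0 0 (b + c) m) (sym (symbols-ones b))
      (passB b (l ∷ ls) ⊣ []
        (onTapes (cong (λ ls → rightwards ls (⊣ ∷ [])) (block-ʳ++ b (l ∷ ls)))
          (runs-read refl (onTapes (left-block b l ls ⊣ [])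
            (backB b l ls (⊣ ∷ []) (≤-trans (≤-reflexive (+-identityʳ b)) b≤V)
              λ rs → recast refl (sym (+-identityʳ b)) refl (k rs))))))

  -- On an input of the right format, the guessing phase starts with the parameters
  -- loaded.
  accept-format : ∀ n a b {m} → 1 ≤ a → a ≤ b → b ≤ n → n ≤ V →
                  (∀ rs → Computes (guess 0F) (leftwards (seen n) rs) a (b ∸ a) (n ∸ b) m) →
                  Computes start (inputTape (encode n a b)) 0 0 0 m
  accept-format n (suc a) b {m} _ a≤b b≤n n≤V k =
    first-block n (ones (suc a) ++ false ∷ ones b) n≤V
      (second-block a (ones b) (𝟎 ∷ seen n)
        (recast refl refl (m+[n∸m]≡n b≤n)
          (third-block b (block (suc a) ++ 𝟎 ∷ seen n) 𝟎 b≤V λ rs →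
            runs-read refl (onTapes (left-block (suc a) 𝟎 (seen n) 𝟎 rs)
              (recast refl (m+[n∸m]≡n a≤b) refl
                (backA (suc a) 𝟎 (seen n) (𝟎 ∷ rs)
                  (≤-trans (≤-reflexive (+-identityʳ (suc a))) (≤-trans a≤b b≤V))
                  λ rs → recast (sym (+-identityʳ (suc a))) refl refl
                    (runs-read refl (onTapes (left-block n ⊢ [] 𝟎 rs) (k (𝟎 ∷ rs))))))))))
    where
    b≤V : b ≤ V
    b≤V = ≤-trans b≤n n≤V

  -- The cases: no zero at all, one zero, an empty second block, b > n, a > b, and a
  -- third zero.  In the last case the third block may be too long for the count or not.
  reject-format : ∀ x → length x ≤ V → ¬ WellFormed x → Computes start (inputTape x) 0 0 0 0
  reject-format x len ¬w with split x
  ... | inj₁ (k , refl) =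
    runs-read refl (onTapes (right-symbols [] ⊢ (ones k))
      (subst (λ z → Computes checkN (rightwards (⊢ ∷ []) z) 0 0 0 0) (sym (symbols-ones k))
        (passN k (⊢ ∷ []) ⊣ [] (≤-trans (≤-reflexive (trans (+-identityʳ k) (sym (length-replicate k)))) len)
          (runs-read refl rejects))))
  ... | inj₂ (n , y , refl) = first-block n y n≤V (second y ¬w (split y))
    where
    n≤V : n ≤ V
    n≤V = ≤-trans (ones-≤-length n) len

    third : ∀ a z → ¬ WellFormed (ones n ++ false ∷ ones (suc a) ++ false ∷ z) →
            (∃[ k ] z ≡ ones k) ⊎ (∃[ k ] ∃[ w ] z ≡ ones k ++ false ∷ w) →
            Computes checkB (rightwards (𝟎 ∷ block (suc a) ++ 𝟎 ∷ seen n) (symbols z)) 0 0 n 0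
    third a _ ¬w (inj₂ (k , w , refl)) =
      subst (λ z → Computes checkB (rightwards _ z) 0 0 n 0) (sym (symbols-block k w)) (by-size (k ≤? n))
      where
      by-size : Dec (k ≤ n) →
                Computes checkB (rightwards (𝟎 ∷ block (suc a) ++ 𝟎 ∷ seen n) (block k ++ 𝟎 ∷ symbols w))
                         0 0 n 0
      by-size (yes k≤n) =
        recast refl refl (m+[n∸m]≡n k≤n) (passB k _ 𝟎 (symbols w) (runs-read refl rejects))
      by-size (no k≰n)  = passB-rejects k _ 𝟎 (symbols w) (≰⇒> k≰n)
    third a _ ¬w (inj₁ (b , refl)) = by-size (b ≤? n) (suc a ≤? b)
      where
      by-size : Dec (b ≤ n) → Dec (suc a ≤ b) →
                Computes checkB (rightwards (𝟎 ∷ block (suc a) ++ 𝟎 ∷ seen n) (symbols (ones b))) 0 0 n 0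
      by-size (yes b≤n) (yes a≤b) = ⊥-elim (¬w (n , suc a , b , s≤s z≤n , a≤b , b≤n , refl))
      by-size (yes b≤n) (no a≰b)  = recast refl refl (m+[n∸m]≡n b≤n)
        (third-block b _ 𝟎 (≤-trans b≤n n≤V) λ rs →
          runs-read refl (onTapes (left-block (suc a) 𝟎 (seen n) 𝟎 rs)
            (backA-rejects (suc a) 𝟎 (seen n) (𝟎 ∷ rs)
              (≤-trans (≤-reflexive (+-identityʳ b)) (≤-trans b≤n n≤V)) (≰⇒> a≰b))))
      by-size (no b≰n)  _         =
        subst (λ z → Computes checkB (rightwards _ z) 0 0 n 0) (sym (symbols-ones b))
          (passB-rejects b _ ⊣ [] (≰⇒> b≰n))

    second : ∀ y → ¬ WellFormed (ones n ++ false ∷ y) →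
             (∃[ k ] y ≡ ones k) ⊎ (∃[ k ] ∃[ z ] y ≡ ones k ++ false ∷ z) →
             Computes checkA₁ (rightwards (𝟎 ∷ seen n) (symbols y)) 0 0 n 0
    second _ _  (inj₁ (zero , refl))  = runs-read refl rejects
    second _ _  (inj₁ (suc k , refl)) =
      subst (λ z → Computes checkA₁ (rightwards (𝟎 ∷ seen n) z) 0 0 n 0) (sym (symbols-ones (suc k)))
        (runs-read refl (onTapes (right-block (𝟎 ∷ seen n) 𝟏 k ⊣ [])
          (passA k (𝟏 ∷ 𝟎 ∷ seen n) ⊣ [] (runs-read refl rejects))))
    second _ _  (inj₂ (zero , z , refl))  = runs-read refl rejects
    second _ ¬w (inj₂ (suc a , z , refl)) = second-block a z (𝟎 ∷ seen n) (third a z ¬w (split z))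

-- The function counted by a program whose guessing phase counts F.
countOf : (ℕ → ℕ → ℕ → ℕ) → ∀ {x} → Dec (WellFormed x) → ℕ
countOf F (yes (n , a , b , _)) = F n a (b ∸ a)
countOf F (no _)                = 0

-- Started with a and d in the counters and n symbols of the first block left, the
-- guessing phase γ has F n a d accepting paths.  The counter #D is raised only when #A is
-- lowered, so a + d bounds both.
Guesses : ∀ {g} → Guessing g → (ℕ → ℕ → ℕ → ℕ) → Set
Guesses γ F = ∀ V n a d b rs → a + d ≤ V →
  Execution.Computes γ V (guess 0F) (leftwards (block n ++ ⊢ ∷ []) rs) a d b (F n a d)

guesses-∈#L : ∀ {g} (γ : Guessing g) F → Guesses γ F →
              (λ x → countOf F (wellFormed? x)) ∈#L
guesses-∈#L γ F guesses = Compile.program-∈#L (program γ) _ λ x → runs x (wellFormed? x)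
  where
  runs : ∀ x (w : Dec (WellFormed x)) →
         Execution.Computes γ (suc (length x)) start (inputTape x) 0 0 0 (countOf F w)
  runs x (no ¬w) = Execution.reject-format γ (suc (length x)) x (n≤1+n _) ¬w
  runs _ (yes (n , a , b , 1≤a , a≤b , b≤n , refl)) =
    Execution.accept-format γ V n a b 1≤a a≤b b≤n n≤V λ rs →
      guesses V n a (b ∸ a) (n ∸ b) rs (≤-trans (≤-reflexive (m+[n∸m]≡n a≤b)) (≤-trans b≤n n≤V))
    where
    V : ℕ
    V = suc (length (encode n a b))
    n≤V : n ≤ V
    n≤V = ≤-trans (ones-≤-length n) (n≤1+n _)

subset-guesses : Guesses subsetGuess subsetPairs
subset-guesses V = elements
  where
  open Execution subsetGuess V

  elements : ∀ n a d b rs → a + d ≤ V →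
             Computes nextElement (leftwards (block n ++ ⊢ ∷ []) rs) a d b (subsetPairs n a d)
  elements zero    a d b rs h = runs-read refl (tests a d)
  elements (suc n) a d b rs h =
    runs-read refl (onTapes (left-block n ⊢ [] 𝟏 rs) (runs-choose refl (first a d h)
      (runs-choose refl (elements n a d b (𝟏 ∷ rs) h) (second a d h))))
    where
    i : Tape InputSymbol
    i = leftwards (block n ++ ⊢ ∷ []) (𝟏 ∷ rs)
    first : ∀ a d → a + d ≤ V → Computes takeFirst i a d b (inFirst n a d)
    first zero    d h = runs-dec⁰ refl refl rejects
    first (suc a) d h = runs-dec⁺ refl refl (runs-choose refl
      (elements n a d b (𝟏 ∷ rs) (≤-trans (n≤1+n _) h))
      (runs-inc refl (≤-trans (s≤s (m≤n+m d a)) h)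
        (elements n a (suc d) b (𝟏 ∷ rs) (≤-trans (≤-reflexive (+-suc a d)) h))))
    second : ∀ a d → a + d ≤ V → Computes onlySecond i a d b (inSecond n a d)
    second a zero    h = runs-dec⁰ refl refl rejects
    second a (suc d) h = runs-dec⁺ refl refl
      (elements n a d b (𝟏 ∷ rs) (≤-trans (+-monoʳ-≤ a (n≤1+n d)) h))

multiset-guesses : Guesses multisetGuess multisetPairs
multiset-guesses V = upper
  where
  open Execution multisetGuess V

  upper : ∀ n a d b rs → a + d ≤ V →
          Computes chooseUpper (leftwards (block n ++ ⊢ ∷ []) rs) a d b (multisetPairs n a d)
  lower : ∀ n a d b rs → a + d ≤ V →
          Computes chooseLower (leftwards (block n ++ ⊢ ∷ []) rs) a d b (afterSecond n a d)
  next  : ∀ n a d b rs → a + d ≤ V →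
          Computes nextValue (leftwards (block n ++ ⊢ ∷ []) rs) a d b (afterFirst n a d)

  upper n a zero    b rs h = runs-choose refl (runs-dec⁰ refl refl rejects) (lower n a zero b rs h)
  upper n a (suc d) b rs h = runs-choose refl
    (runs-dec⁺ refl refl (upper n a d b rs (≤-trans (+-monoʳ-≤ a (n≤1+n d)) h)))
    (lower n a (suc d) b rs h)

  lower n zero    d b rs h = runs-choose refl (runs-dec⁰ refl refl rejects) (next n zero d b rs h)
  lower n (suc a) d b rs h = runs-choose refl
    (runs-dec⁺ refl refl (runs-inc refl (≤-trans (s≤s (m≤n+m d a)) h)
      (lower n a (suc d) b rs (≤-trans (≤-reflexive (+-suc a d)) h))))
    (next n (suc a) d b rs h)

  next zero    a d b rs h = runs-read refl (tests a d)
  next (suc n) a d b rs h = runs-read refl (onTapes (left-block n ⊢ [] 𝟏 rs) (upper n a d b (𝟏 ∷ rs) h))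

extends : ∀ F G → (∀ n a b → 1 ≤ a → a ≤ b → + F n a (b ∸ a) ≡ G n a b) →
          ∀ x → + countOf F (wellFormed? x) ≡ extendByZero G x
extends F G F≡G x with wellFormed? x
... | yes (n , a , b , 1≤a , a≤b , _) = F≡G n a b 1≤a a≤b
... | no _                            = refl

corollary3p20 : (∃[ f ] f ∈#L × (∀ x → + f x ≡ extendByZero (λ n a b →
    ((n C a) * (n C b)) ⊖ ((n C (a ∸ 1)) * (n C (b + 1)))) x))
    ×
    (∃[ f ] f ∈#L × (∀ x → + f x ≡ extendByZero (λ n a b →
    (((n + a) C n) * ((n + b) C n)) ⊖ (((n + a ∸ 1) C n) * ((n + b + 1) C n))) x))
corollary3p20 =
  (_ , guesses-∈#L subsetGuess subsetPairs subset-guesses , extends _ _ subsetPairs-difference) ,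
  (_ , guesses-∈#L multisetGuess multisetPairs multiset-guesses , extends _ _ multisetPairs-difference)
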